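{- Let $p$ be a prime and let $w:\mathbb{F}_p^3\to\mathbb{Z}_{\ge 0}$ be a $p$-divisible multiset, that is, for every affine plane $H\subseteq\mathbb{F}_p^3$, $$\sum_{x\in H} w(x)\equiv 0\pmod p.$$ Assume moreover that $\sum_{x\in\mathbb{F}_p^3} w(x)=p^2$. Then for any affine plane $H\subseteq\mathbb{F}_p^3$, $$w-\mathbf{1}_H\in\operatorname{Span}_{\mathbb{Z}}\{\mathbf{1}_{\ell_1}-\mathbf{1}_{\ell_2} : \ell_1,\ell_2 \text{ affine lines in } \mathbb{F}_p^3,\ \ell_1\parallel\ell_2\}.$$ Equivalently, $w$ is a $\mathbb{Z}$-linear combination of characteristic functions of cylinders.
   Context: Lines and planes are affine one- and two-dimensional subspaces of $\mathbb{F}_p^3$. For $X\subseteq\mathbb{F}_p^3$, $\mathbf{1}_X:\mathbb{F}_p^3\to\mathbb{Z}$ denotes its characteristic function. Write $\ell_1\parallel\ell_2$ if the lines $\ell_1,\ell_2$ are parallel. A cylinder is a subset of $\mathbb{F}_p^3$ that is the union of $p$ pairwise disjoint parallel lines. $\operatorname{Span}_{\mathbb{Z}}$ denotes the set of finite integer linear combinations. -}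

module Defs where

open import Data.Bool.Base using (if_then_else_)
open import Data.Fin.Base using (Fin; toℕ)
open import Data.Fin.Properties using (any?)
import Data.Fin.Properties as Fin
open import Data.Integer.Base as ℤ using (ℤ; 0ℤ; 1ℤ)
open import Data.List.Base as List using (List; []; _∷_; allFin; cartesianProductWith; filter; foldr)
open import Data.List.Membership.Propositional using (_∈_)
open import Data.List.Membership.Propositional.Properties using (∈-allFin; ∈-cartesianProductWith⁺)
import Data.List.Relation.Unary.Any as Any
open import Data.List.Relation.Unary.Any using (here)
open import Data.Nat.Base as ℕ using (ℕ; NonZero)
open import Data.Nat.Divisibility using (_∣_)
open import Data.Nat.DivMod using (_mod_)
open import Data.Nat.ListAction using (sum)
open import Data.Nat.Primality using (Prime; prime⇒nonZero)
open import Data.Product.Base using (Σ; ∃₂; ∃-syntax; _×_; _,_)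
open import Data.Vec.Base as Vec using (Vec; []; _∷_; replicate; zipWith)
import Data.Vec.Properties as Vec
open import Level using (0ℓ)
open import Relation.Binary.Definitions using (DecidableEquality)
open import Relation.Binary.PropositionalEquality using (_≡_; _≢_; refl)
open import Relation.Nullary.Decidable using (does; map′)
open import Relation.Unary using (Pred; Decidable; _⊥_; _≐_)

-- The p-element field is Fin p with arithmetic modulo p.

module AffineGeometry (p : ℕ) (p-prime : Prime p) where

  private instance
    p-nonZero : NonZero p
    p-nonZero = prime⇒nonZero p-prime

  infixl 6 _+ᶠ_ _+ᵛ_
  infixl 7 _*ᶠ_ _*ᵛ_

  𝔽 : Set
  𝔽 = Fin p

  0ᶠ : 𝔽
  0ᶠ = 0 mod p

  _+ᶠ_ _*ᶠ_ : 𝔽 → 𝔽 → 𝔽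
  a +ᶠ b = (toℕ a ℕ.+ toℕ b) mod p
  a *ᶠ b = (toℕ a ℕ.* toℕ b) mod p

  Point : Set
  Point = Vec 𝔽 3

  _≟_ : DecidableEquality Point
  _≟_ = Vec.≡-dec Fin._≟_

  0ᵛ : Point
  0ᵛ = replicate 3 0ᶠ

  _+ᵛ_ : Point → Point → Point
  _+ᵛ_ = zipWith _+ᶠ_

  _*ᵛ_ : 𝔽 → Point → Point
  c *ᵛ v = Vec.map (c *ᶠ_) v

  linComb : ∀ {k} → Vec 𝔽 k → Vec Point k → Point
  linComb []       []       = 0ᵛ
  linComb (c ∷ cs) (v ∷ vs) = c *ᵛ v +ᵛ linComb cs vs

  LinearlyIndependent : ∀ {k} → Vec Point k → Set
  LinearlyIndependent {k} vs = ∀ cs → linComb cs vs ≡ 0ᵛ → cs ≡ replicate k 0ᶠ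

  allVecs : ∀ k → List (Vec 𝔽 k)
  allVecs ℕ.zero    = [] ∷ []
  allVecs (ℕ.suc k) = cartesianProductWith _∷_ (allFin p) (allVecs k)

  ∈-allVecs : ∀ {k} (v : Vec 𝔽 k) → v ∈ allVecs k
  ∈-allVecs []      = here refl
  ∈-allVecs (a ∷ v) = ∈-cartesianProductWith⁺ _∷_ (∈-allFin a) (∈-allVecs v)

  points : List Point
  points = allVecs 3

  -- A k-dimensional affine subspace, presented by a point and a basis of its
  -- direction space.  Different presentations may have the same point set;
  -- everything below depends on the point set only.

  record AffineSubspace (k : ℕ) : Set where
    field
      base        : Point
      basis       : Vec Point k
      independent : LinearlyIndependent basis

    Direction : Pred Point 0ℓ
    Direction v = ∃[ cs ] v ≡ linComb cs basis

    Points : Pred Point 0ℓ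
    Points x = ∃[ cs ] x ≡ base +ᵛ linComb cs basis

    points? : Decidable Points
    points? x = map′ Any.satisfied (λ (cs , eq) → Any.map (λ { refl → eq }) (∈-allVecs cs))
                  (Any.any? (λ cs → x ≟ (base +ᵛ linComb cs basis)) (allVecs k))

  open AffineSubspace public

  Line Plane : Set
  Line  = AffineSubspace 1
  Plane = AffineSubspace 2

  infix 4 _∥_

  _∥_ : Line → Line → Set
  ℓ₁ ∥ ℓ₂ = Direction ℓ₁ ≐ Direction ℓ₂

  record Cylinder : Set where
    field
      lines    : Fin p → Line
      parallel : ∀ i j → lines i ∥ lines j
      disjoint : ∀ i j → i ≢ j → Points (lines i) ⊥ Points (lines j)

    Union : Pred Point 0ℓ
    Union x = ∃[ i ] Points (lines i) x

    union? : Decidable Union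
    union? x = any? (λ i → points? (lines i) x)

  open Cylinder public

  -- The characteristic function of X, where X is given by a decision procedure.

  𝟙 : {X : Pred Point 0ℓ} → Decidable X → Point → ℤ
  𝟙 X? x = if does (X? x) then 1ℤ else 0ℤ

  infixl 6 _-ᵐ_

  _-ᵐ_ : (Point → ℤ) → (Point → ℤ) → Point → ℤ
  (f -ᵐ g) x = f x ℤ.- g x

  -- f ∈Spanℤ g : f is a finite integer combination of the family g, as a
  -- function on points; an index may occur several times in the list.

  infix 4 _∈Spanℤ_

  _∈Spanℤ_ : {I : Set} → (Point → ℤ) → (I → Point → ℤ) → Set
  _∈Spanℤ_ {I} f g = Σ (List (ℤ × I)) λ terms →
    ∀ x → f x ≡ foldr ℤ._+_ 0ℤ (List.map (λ (c , i) → c ℤ.* g i x) terms)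

  ParallelPair : Set
  ParallelPair = ∃₂ λ (ℓ₁ ℓ₂ : Line) → ℓ₁ ∥ ℓ₂

  lineDifference : ParallelPair → Point → ℤ
  lineDifference (ℓ₁ , ℓ₂ , _) = 𝟙 (points? ℓ₁) -ᵐ 𝟙 (points? ℓ₂)

  𝟙ᴾ : Plane → Point → ℤ
  𝟙ᴾ H = 𝟙 (points? H)

  𝟙ᶜ : Cylinder → Point → ℤ
  𝟙ᶜ C = 𝟙 (union? C)

  toℤ : (Point → ℕ) → Point → ℤ
  toℤ w x = ℤ.+ w x

  total : (Point → ℕ) → ℕ
  total w = sum (List.map w points)

  sumOver : Plane → (Point → ℕ) → ℕ
  sumOver H w = sum (List.map w (filter (points? H) points))

  Divisible : (Point → ℕ) → Set
  Divisible w = (H : Plane) → p ∣ sumOver H w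

{-# OPTIONS --safe #-}

-- For the group E of integer functions modulo the span of the parallel-line differences, let h(x) ∈ E be the class of
-- the indicator of x.  The sum of h over a line depends only on the direction.
--
-- Djoković's identity: for v₁, …, v_{p-1}, summing ∏ⱼ (1 - T^{(1 + k j) vⱼ}) h over k ∈ 𝔽 leaves only the term k = 0,
-- because for k ≠ 0 some j has 1 + k j = 0; on the other hand the sum is a combination of line sums of h.  Hence
-- (p-1)-fold differences of h are constant and p-fold differences vanish: h is polynomial of degree < p.
--
-- In the Newton expansion ∑ₓ w(x) h(x) = ∑ₜ (∑ₓ w(x) C(x,t)) Δᵗh(0), the terms with |t| ≥ p therefore vanish.  For
-- 0 < |t| < p, C(x,t) is mod p, up to a unit, a product of fewer than p affine forms, so by polarization a combination
-- of functions of a single affine form, against which w sums to 0 since it is p-divisible; and p Δᵗh(0) = 0.  What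
-- remains is w ≡ p² h(0), and likewise 𝟙ᴴ ≡ p² h(0).  The same argument modulo cylinders gives
-- w ≡ p² h(0) ≡ (a cylinder) ≡ 0.

module Submission where

open import Defs
open import Algebra.Bundles using (AbelianGroup; CommutativeMonoid; CommutativeRing)
open import Data.Bool.Base using (if_then_else_; true; false)
open import Data.Empty using (⊥)
open import Data.Fin.Base as Fin using (Fin; toℕ; zero; suc)
open import Data.Fin.Patterns using (0F; 1F; 2F)
import Data.Fin.Properties as Fin
open import Data.Integer.Base as ℤ using (ℤ; 0ℤ; 1ℤ)
import Data.Integer.Properties as ℤ
import Data.Integer.Solver
open import Data.List.Base as List
  using (List; []; _∷_; _++_; length; foldr; map; filter; cartesianProductWith; tabulate; allFin)
import Data.List.Properties as List
open import Data.List.Relation.Unary.All using (All; []; _∷_)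
import Data.List.Relation.Unary.All.Properties as All
open import Data.Nat.Base as ℕ using (ℕ; NonZero; _^_; _!)
open import Data.Nat.Combinatorics using (_C_; nCk+nC[k+1]≡[n+1]C[k+1])
open import Data.Nat.Coprimality using (prime⇒coprime; coprime-Bézout)
open import Data.Nat.Divisibility using (_∣_; divides; ∣-refl; n∣m*n; m∣m*n; m%n≡0⇒n∣m; n∣m⇒m%n≡0; ∣⇒≤)
open import Data.Nat.DivMod using (_mod_; _%_; %-distribˡ-+; %-distribˡ-*; m<n⇒m%n≡m)
open import Data.Nat.GCD using (module Bézout)
open import Data.Nat.ListAction using () renaming (sum to sumᴸ)
open import Data.Nat.ListAction.Properties using (sum-++)
open import Data.Nat.Primality using (Prime; prime⇒nonZero; prime⇒nonTrivial)
import Data.Nat.Properties as ℕ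
import Data.Nat.Solver
open import Data.Product.Base using (∃; ∃₂; _×_; _,_; proj₁; proj₂)
open import Data.Vec.Base as Vec using (Vec; []; _∷_; replicate; lookup; insertAt; removeAt)
import Data.Vec.Properties as Vec
open import Function.Base using (_∘_; _$_)
open import Function.Bundles using (_⇔_; mk⇔; Equivalence)
open import Level using (0ℓ)
open import Relation.Binary.PropositionalEquality
  using (_≡_; _≢_; refl; sym; trans; cong; cong₂; subst; module ≡-Reasoning; isEquivalence)
open import Relation.Nullary using (Dec; yes; no; does; contradiction)
open import Relation.Nullary.Decidable using (does-⇔; dec-true; dec-false)
open import Relation.Unary using (Pred; Decidable)

-- The class h(0) is not killed by `p`: the sum of all values of a function descends to E (modulo
-- cylinders, up to multiples of p²). Djoković's identity holds over ℤ and replaces it there;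
-- polarization is confined to the weights C(x,t), whose residues do lie in 𝔽. The two sides meet
-- because p h is constant, so that `p` kills every difference of h. All of this sees E only through
-- one property: the sum of h over a line depends on the direction alone. Modulo parallel-line
-- differences that is a generator. Modulo cylinders it has to be proved: two cylinders that differ
-- in a single line identify the two lines in which they differ, and such exchanges connect all
-- parallel lines. The second conclusion is then a second run of the abstract argument and is not
-- deduced from the first.

-- Finite sums over vectors in a commutative monoid.

module VecSum {c ℓ} (M : CommutativeMonoid c ℓ) (n : ℕ) where

  open CommutativeMonoid M using (Carrier; _≈_; _∙_; ε)
    renaming (refl to ≈-refl; trans to ≈-trans; ∙-cong to +-cong)
  open import Algebra.Properties.CommutativeMonoid.Sum M public

  sum-cong : ∀ {m} {f g : Fin m → Carrier} → (∀ i → f i ≈ g i) → sum f ≈ sum g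
  sum-cong = sum-cong-≋

  sum-zero : ∀ {m} {f : Fin m → Carrier} → (∀ i → f i ≈ ε) → sum f ≈ ε
  sum-zero {m} f≈ε = ≈-trans (sum-cong f≈ε) (sum-replicate-zero m)

  sum-single : ∀ {m} {f : Fin m → Carrier} i → (∀ j → j ≢ i → f j ≈ ε) → sum f ≈ f i
  sum-single {ℕ.suc m} zero    f≈ε =
    ≈-trans (+-cong ≈-refl (sum-zero λ j → f≈ε (suc j) λ ())) (CommutativeMonoid.identityʳ M _)
  sum-single {ℕ.suc m} (suc i) f≈ε =
    ≈-trans (+-cong (f≈ε zero λ ()) (sum-single i λ j j≢i → f≈ε (suc j) (j≢i ∘ Fin.suc-injective)))
      (CommutativeMonoid.identityˡ M _)

  -- Iterated with the first coordinate outermost, the order in which `allVecs` lists the vectors.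
  ∑ⱽ : ∀ {k} → (Vec (Fin n) k → Carrier) → Carrier
  ∑ⱽ {ℕ.zero}  f = f []
  ∑ⱽ {ℕ.suc k} f = ∑[ a < n ] ∑ⱽ λ v → f (a ∷ v)

  ∑ⱽ-cong : ∀ {k} {f g : Vec (Fin n) k → Carrier} → (∀ v → f v ≈ g v) → ∑ⱽ f ≈ ∑ⱽ g
  ∑ⱽ-cong {ℕ.zero}  f≈g = f≈g []
  ∑ⱽ-cong {ℕ.suc k} f≈g = sum-cong λ a → ∑ⱽ-cong λ v → f≈g (a ∷ v)

  ∑ⱽ-zero : ∀ {k} {f : Vec (Fin n) k → Carrier} → (∀ v → f v ≈ ε) → ∑ⱽ f ≈ ε
  ∑ⱽ-zero {ℕ.zero}  f≈ε = f≈ε []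
  ∑ⱽ-zero {ℕ.suc k} f≈ε = sum-zero λ a → ∑ⱽ-zero λ v → f≈ε (a ∷ v)

  ∑ⱽ-single : ∀ {k} {f : Vec (Fin n) k → Carrier} u → (∀ v → v ≢ u → f v ≈ ε) → ∑ⱽ f ≈ f u
  ∑ⱽ-single []      f≈ε = ≈-refl
  ∑ⱽ-single (a ∷ u) f≈ε = ≈-trans
    (sum-single a λ b b≢a → ∑ⱽ-zero λ v → f≈ε (b ∷ v) λ { refl → b≢a refl })
    (∑ⱽ-single u λ v v≢u → f≈ε (a ∷ v) λ { refl → v≢u refl })

  ∑ⱽ-distrib-∙ : ∀ {k} (f g : Vec (Fin n) k → Carrier) → ∑ⱽ (λ v → f v ∙ g v) ≈ ∑ⱽ f ∙ ∑ⱽ g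
  ∑ⱽ-distrib-∙ {ℕ.zero}  f g = ≈-refl
  ∑ⱽ-distrib-∙ {ℕ.suc k} f g = ≈-trans
    (sum-cong λ a → ∑ⱽ-distrib-∙ (λ v → f (a ∷ v)) (λ v → g (a ∷ v)))
    (∑-distrib-+ (λ a → ∑ⱽ λ v → f (a ∷ v)) (λ a → ∑ⱽ λ v → g (a ∷ v)))

  ∑ⱽ-∑-comm : ∀ {k m} (f : Vec (Fin n) k → Fin m → Carrier) →
    ∑ⱽ (λ v → sum (f v)) ≈ ∑[ j < m ] ∑ⱽ (λ v → f v j)
  ∑ⱽ-∑-comm {ℕ.zero}  f = ≈-refl
  ∑ⱽ-∑-comm {ℕ.suc k} f = ≈-trans (sum-cong λ a → ∑ⱽ-∑-comm λ v → f (a ∷ v)) (∑-comm λ a j → ∑ⱽ λ v → f (a ∷ v) j)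

  ∑ⱽ-comm : ∀ {k l} (f : Vec (Fin n) k → Vec (Fin n) l → Carrier) →
    ∑ⱽ (λ u → ∑ⱽ (f u)) ≈ ∑ⱽ (λ v → ∑ⱽ (λ u → f u v))
  ∑ⱽ-comm {l = ℕ.zero}  f = ≈-refl
  ∑ⱽ-comm {l = ℕ.suc l} f =
    ≈-trans (∑ⱽ-∑-comm λ u a → ∑ⱽ λ v → f u (a ∷ v)) (sum-cong λ a → ∑ⱽ-comm λ u v → f u (a ∷ v))

module _ {c ℓ c′ ℓ′} (M : CommutativeMonoid c ℓ) (N : CommutativeMonoid c′ ℓ′) (n : ℕ) where
  private
    module M = CommutativeMonoid M
    module N = CommutativeMonoid N
    module ΣM = VecSum M n
    module ΣN = VecSum N n

  module _ (φ : M.Carrier → N.Carrier) (φ-ε : φ M.ε N.≈ N.ε)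
           (φ-∙ : ∀ x y → φ (x M.∙ y) N.≈ φ x N.∙ φ y) where

    sum-hom : ∀ {m} (f : Fin m → M.Carrier) → φ (ΣM.sum f) N.≈ ΣN.sum (φ ∘ f)
    sum-hom {ℕ.zero}  f = φ-ε
    sum-hom {ℕ.suc m} f = N.trans (φ-∙ _ _) (N.∙-congˡ (sum-hom (f ∘ suc)))

    ∑ⱽ-hom : ∀ {k} (f : Vec (Fin n) k → M.Carrier) → φ (ΣM.∑ⱽ f) N.≈ ΣN.∑ⱽ (φ ∘ f)
    ∑ⱽ-hom {ℕ.zero}  f = N.refl
    ∑ⱽ-hom {ℕ.suc k} f =
      N.trans (sum-hom λ a → ΣM.∑ⱽ λ v → f (a ∷ v)) (ΣN.sum-cong λ a → ∑ⱽ-hom λ v → f (a ∷ v))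

-- Arithmetic of the field with `p` elements.

module PrimeField (p : ℕ) (p-prime : Prime p) where

  open AffineGeometry p p-prime

  private instance
    p-nonZero : NonZero p
    p-nonZero = prime⇒nonZero p-prime

  ι : ℕ → 𝔽
  ι n = n mod p

  toℕ-ι : ∀ n → toℕ (ι n) ≡ n % p
  toℕ-ι n = Fin.toℕ-fromℕ< _

  ι-toℕ : ∀ a → ι (toℕ a) ≡ a
  ι-toℕ a = Fin.toℕ-injective (trans (toℕ-ι _) (m<n⇒m%n≡m (Fin.toℕ<n a)))

  ι-cong-% : ∀ {m n} → m % p ≡ n % p → ι m ≡ ι n
  ι-cong-% eq = Fin.toℕ-injective (trans (toℕ-ι _) (trans eq (sym (toℕ-ι _))))

  ι-homo-+ : ∀ m n → ι (m ℕ.+ n) ≡ ι m +ᶠ ι n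
  ι-homo-+ m n = ι-cong-% (trans (%-distribˡ-+ m n p)
    (sym (cong₂ (λ x y → (x ℕ.+ y) % p) (toℕ-ι m) (toℕ-ι n))))

  ι-homo-* : ∀ m n → ι (m ℕ.* n) ≡ ι m *ᶠ ι n
  ι-homo-* m n = ι-cong-% (trans (%-distribˡ-* m n p)
    (sym (cong₂ (λ x y → (x ℕ.* y) % p) (toℕ-ι m) (toℕ-ι n))))

  toℕ-0ᶠ : toℕ 0ᶠ ≡ 0
  toℕ-0ᶠ = trans (toℕ-ι 0) (m<n⇒m%n≡m (ℕ.>-nonZero⁻¹ p))

  ι≡0⇒∣ : ∀ n → ι n ≡ 0ᶠ → p ∣ n
  ι≡0⇒∣ n eq = m%n≡0⇒n∣m n p (trans (sym (toℕ-ι n)) (trans (cong toℕ eq) toℕ-0ᶠ))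

  ∣⇒ι≡0 : ∀ n → p ∣ n → ι n ≡ 0ᶠ
  ∣⇒ι≡0 n p∣n = Fin.toℕ-injective (trans (toℕ-ι n) (trans (n∣m⇒m%n≡0 n p p∣n) (sym toℕ-0ᶠ)))

  1ᶠ : 𝔽
  1ᶠ = ι 1

  neg : 𝔽 → 𝔽
  neg a = ι (p ℕ.∸ toℕ a)

  private
    -- Once every element is written as `ι n`, a ring law of 𝔽 is the image under `ι` of the same
    -- law in ℕ.
    surjective : ∀ a → ∃ λ n → a ≡ ι n
    surjective a = toℕ a , sym (ι-toℕ a)

  +ᶠ-assoc : ∀ a b c → (a +ᶠ b) +ᶠ c ≡ a +ᶠ (b +ᶠ c)
  +ᶠ-assoc a b c with l , refl ← surjective a | m , refl ← surjective b | n , refl ← surjective c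
    rewrite sym (ι-homo-+ l m) | sym (ι-homo-+ m n) | sym (ι-homo-+ (l ℕ.+ m) n) | sym (ι-homo-+ l (m ℕ.+ n))
    = cong ι (ℕ.+-assoc l m n)

  +ᶠ-comm : ∀ a b → a +ᶠ b ≡ b +ᶠ a
  +ᶠ-comm a b = cong ι (ℕ.+-comm (toℕ a) (toℕ b))

  *ᶠ-assoc : ∀ a b c → (a *ᶠ b) *ᶠ c ≡ a *ᶠ (b *ᶠ c)
  *ᶠ-assoc a b c with l , refl ← surjective a | m , refl ← surjective b | n , refl ← surjective c
    rewrite sym (ι-homo-* l m) | sym (ι-homo-* m n) | sym (ι-homo-* (l ℕ.* m) n) | sym (ι-homo-* l (m ℕ.* n))
    = cong ι (ℕ.*-assoc l m n)

  *ᶠ-comm : ∀ a b → a *ᶠ b ≡ b *ᶠ a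
  *ᶠ-comm a b = cong ι (ℕ.*-comm (toℕ a) (toℕ b))

  +ᶠ-identityˡ : ∀ a → 0ᶠ +ᶠ a ≡ a
  +ᶠ-identityˡ a = trans (cong (λ n → ι (n ℕ.+ toℕ a)) toℕ-0ᶠ) (ι-toℕ a)

  *ᶠ-identityˡ : ∀ a → 1ᶠ *ᶠ a ≡ a
  *ᶠ-identityˡ a with n , refl ← surjective a = trans (sym (ι-homo-* 1 n)) (cong ι (ℕ.*-identityˡ n))

  neg-inverseˡ : ∀ a → neg a +ᶠ a ≡ 0ᶠ
  neg-inverseˡ a = begin
    neg a +ᶠ a                   ≡⟨ cong (neg a +ᶠ_) (ι-toℕ a) ⟨
    neg a +ᶠ ι (toℕ a)           ≡⟨ ι-homo-+ (p ℕ.∸ toℕ a) (toℕ a) ⟨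
    ι (p ℕ.∸ toℕ a ℕ.+ toℕ a)   ≡⟨ cong ι (ℕ.m∸n+n≡m (ℕ.<⇒≤ (Fin.toℕ<n a))) ⟩
    ι p                         ≡⟨ ∣⇒ι≡0 p ∣-refl ⟩
    0ᶠ                          ∎
    where open ≡-Reasoning

  *ᶠ-distribʳ-+ᶠ : ∀ c a b → (a +ᶠ b) *ᶠ c ≡ a *ᶠ c +ᶠ b *ᶠ c
  *ᶠ-distribʳ-+ᶠ c a b with l , refl ← surjective a | m , refl ← surjective b | n , refl ← surjective c
    rewrite sym (ι-homo-+ l m) | sym (ι-homo-* (l ℕ.+ m) n) | sym (ι-homo-* l n) | sym (ι-homo-* m n)
      | sym (ι-homo-+ (l ℕ.* n) (m ℕ.* n))
    = cong ι (ℕ.*-distribʳ-+ n l m)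

  𝔽-commutativeRing : CommutativeRing 0ℓ 0ℓ
  𝔽-commutativeRing = record
    { Carrier = 𝔽 ; _≈_ = _≡_ ; _+_ = _+ᶠ_ ; _*_ = _*ᶠ_ ; -_ = neg ; 0# = 0ᶠ ; 1# = 1ᶠ
    ; isCommutativeRing = record
      { isRing = record
        { +-isAbelianGroup = record
          { isGroup = record
            { isMonoid = record
              { isSemigroup = record
                { isMagma = record { isEquivalence = isEquivalence ; ∙-cong = cong₂ _+ᶠ_ }
                ; assoc = +ᶠ-assoc }
              ; identity = comm∧idˡ⇒id +ᶠ-comm +ᶠ-identityˡ }
            ; inverse = comm∧invˡ⇒inv +ᶠ-comm neg-inverseˡ
            ; ⁻¹-cong = cong neg }
          ; comm = +ᶠ-comm }
        ; *-cong = cong₂ _*ᶠ_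
        ; *-assoc = *ᶠ-assoc
        ; *-identity = comm∧idˡ⇒id *ᶠ-comm *ᶠ-identityˡ
        ; distrib = comm∧distrʳ⇒distrˡ *ᶠ-comm *ᶠ-distribʳ-+ᶠ , *ᶠ-distribʳ-+ᶠ }
      ; *-comm = *ᶠ-comm } }
    where open import Algebra.Consequences.Propositional

  open CommutativeRing 𝔽-commutativeRing public using ()
    renaming ( +-identityʳ to +ᶠ-identityʳ; *-identityʳ to *ᶠ-identityʳ; zeroˡ to *ᶠ-zeroˡ; zeroʳ to *ᶠ-zeroʳ
             ; distribˡ to *ᶠ-distribˡ-+ᶠ; -‿inverseʳ to neg-inverseʳ
             ; commutativeSemiring to 𝔽-commutativeSemiring; +-commutativeMonoid to 𝔽-+-commutativeMonoid)

  open import Algebra.Properties.Group (CommutativeRing.+-group 𝔽-commutativeRing) public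
    using () renaming (∙-cancelˡ to +ᶠ-cancelˡ; ∙-cancelʳ to +ᶠ-cancelʳ)
  open import Algebra.Solver.Ring.NaturalCoefficients.Default 𝔽-commutativeSemiring public
    using (solve; _:+_; _:*_; _:=_; con)

  1<p : 1 ℕ.< p
  1<p = ℕ.nonTrivial⇒n>1 p where instance _ = prime⇒nonTrivial p-prime

  ι-<-≢0 : ∀ {n} → 0 ℕ.< n → n ℕ.< p → ι n ≢ 0ᶠ
  ι-<-≢0 {n} 0<n n<p ιn≡0 = ℕ.<⇒≱ n<p (∣⇒≤ {{ℕ.>-nonZero 0<n}} (ι≡0⇒∣ n ιn≡0))

  1ᶠ≢0ᶠ : 1ᶠ ≢ 0ᶠ
  1ᶠ≢0ᶠ = ι-<-≢0 (ℕ.s≤s ℕ.z≤n) 1<p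

  toℕ-≢0 : ∀ {a} → a ≢ 0ᶠ → toℕ a ≢ 0
  toℕ-≢0 a≢0 eq = a≢0 (Fin.toℕ-injective (trans eq (sym toℕ-0ᶠ)))

  inverse : ∀ a → a ≢ 0ᶠ → ∃ λ b → b *ᶠ a ≡ 1ᶠ
  inverse a a≢0 with coprime-Bézout (prime⇒coprime p-prime {{ℕ.≢-nonZero (toℕ-≢0 a≢0)}} (Fin.toℕ<n a))
  ... | Bézout.-+ x y eq = ι y , (begin
    ι y *ᶠ a            ≡⟨ cong (ι y *ᶠ_) (ι-toℕ a) ⟨
    ι y *ᶠ ι (toℕ a)    ≡⟨ ι-homo-* y (toℕ a) ⟨
    ι (y ℕ.* toℕ a)     ≡⟨ cong ι eq ⟨
    ι (1 ℕ.+ x ℕ.* p)   ≡⟨ ι-homo-+ 1 (x ℕ.* p) ⟩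
    1ᶠ +ᶠ ι (x ℕ.* p)   ≡⟨ cong (1ᶠ +ᶠ_) (∣⇒ι≡0 _ (n∣m*n x)) ⟩
    1ᶠ +ᶠ 0ᶠ            ≡⟨ +ᶠ-identityʳ 1ᶠ ⟩
    1ᶠ                  ∎)
    where open ≡-Reasoning
  -- Here Bézout reads `1 + y a = x p`, so `y a` is -1 modulo `p` and the inverse is the negative of
  -- `ι y`.
  ... | Bézout.+- x y eq = neg (ι y) , (begin
    neg (ι y) *ᶠ a                              ≡⟨ -‿distribˡ-* (ι y) a ⟨
    neg (ι y *ᶠ a)                              ≡⟨ +ᶠ-identityˡ _ ⟨
    0ᶠ +ᶠ neg (ι y *ᶠ a)                        ≡⟨ cong (_+ᶠ neg (ι y *ᶠ a)) (∣⇒ι≡0 _ (n∣m*n x)) ⟨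
    ι (x ℕ.* p) +ᶠ neg (ι y *ᶠ a)               ≡⟨ cong (λ n → ι n +ᶠ neg (ι y *ᶠ a)) eq ⟨
    ι (1 ℕ.+ y ℕ.* toℕ a) +ᶠ neg (ι y *ᶠ a)
      ≡⟨ cong (_+ᶠ neg (ι y *ᶠ a)) (trans (ι-homo-+ 1 _)
           (cong (1ᶠ +ᶠ_) (trans (ι-homo-* y (toℕ a)) (cong (ι y *ᶠ_) (ι-toℕ a))))) ⟩
    (1ᶠ +ᶠ ι y *ᶠ a) +ᶠ neg (ι y *ᶠ a)          ≡⟨ +ᶠ-assoc 1ᶠ _ _ ⟩
    1ᶠ +ᶠ (ι y *ᶠ a +ᶠ neg (ι y *ᶠ a))          ≡⟨ cong (1ᶠ +ᶠ_) (neg-inverseʳ (ι y *ᶠ a)) ⟩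
    1ᶠ +ᶠ 0ᶠ                                   ≡⟨ +ᶠ-identityʳ 1ᶠ ⟩
    1ᶠ                                         ∎)
    where
    open ≡-Reasoning
    open import Algebra.Properties.Ring (CommutativeRing.ring 𝔽-commutativeRing) using (-‿distribˡ-*)

  *ᶠ-cancelˡ : ∀ a {b c} → a ≢ 0ᶠ → a *ᶠ b ≡ a *ᶠ c → b ≡ c
  *ᶠ-cancelˡ a {b} {c} a≢0 eq = begin
    b                ≡⟨ undo b ⟨
    a⁻¹ *ᶠ (a *ᶠ b)  ≡⟨ cong (a⁻¹ *ᶠ_) eq ⟩
    a⁻¹ *ᶠ (a *ᶠ c)  ≡⟨ undo c ⟩
    c                ∎
    where
    open ≡-Reasoning
    a⁻¹ = proj₁ (inverse a a≢0)
    undo : ∀ x → a⁻¹ *ᶠ (a *ᶠ x) ≡ x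
    undo x = trans (sym (*ᶠ-assoc a⁻¹ a x)) (trans (cong (_*ᶠ x) (proj₂ (inverse a a≢0))) (*ᶠ-identityˡ x))

  *ᶠ-≡0 : ∀ a {b} → a ≢ 0ᶠ → a *ᶠ b ≡ 0ᶠ → b ≡ 0ᶠ
  *ᶠ-≡0 a a≢0 eq = *ᶠ-cancelˡ a a≢0 (trans eq (sym (*ᶠ-zeroʳ a)))

  *ᶠ-≢0 : ∀ {a b} → a ≢ 0ᶠ → b ≢ 0ᶠ → a *ᶠ b ≢ 0ᶠ
  *ᶠ-≢0 {a} a≢0 b≢0 eq = b≢0 (*ᶠ-≡0 a a≢0 eq)

  module 𝔽Σ = VecSum 𝔽-+-commutativeMonoid p

-- Identities in ℕ for binomial coefficients and list sums.

private module ℕSolver = Data.Nat.Solver.+-*-Solver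

-- This is (n - k) C(n,k) = (k + 1) C(n,k+1) freed of subtraction, so that `ι` can carry it to 𝔽. It
-- follows from Pascal's rule and the two instances for `n - 1`.
binomial-absorption : ∀ n k → ℕ.suc k ℕ.* (n C ℕ.suc k) ℕ.+ k ℕ.* (n C k) ≡ n ℕ.* (n C k)
binomial-absorption ℕ.zero    ℕ.zero    = refl
binomial-absorption ℕ.zero    (ℕ.suc k) = cong₂ ℕ._+_ (ℕ.*-zeroʳ k) (ℕ.*-zeroʳ k)
binomial-absorption (ℕ.suc n) ℕ.zero    rewrite sym (nCk+nC[k+1]≡[n+1]C[k+1] n 0) =
  trans (solve 1 (λ b → con 1 :* (con 1 :+ b) :+ con 0 := con 1 :+ (con 1 :* b :+ con 0 :* con 1)) refl (n C 1))
    (cong ℕ.suc (binomial-absorption n 0))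
  where open ℕSolver
binomial-absorption (ℕ.suc n) (ℕ.suc k)
  rewrite sym (nCk+nC[k+1]≡[n+1]C[k+1] n k) | sym (nCk+nC[k+1]≡[n+1]C[k+1] n (ℕ.suc k)) = begin
    (2 ℕ.+ k) ℕ.* (A ℕ.+ B) ℕ.+ (1 ℕ.+ k) ℕ.* (Z ℕ.+ A)
      ≡⟨ solve 4 (λ k A B Z → (con 2 :+ k) :* (A :+ B) :+ (con 1 :+ k) :* (Z :+ A)
           := (con 2 :+ k) :* A :+ (con 1 :+ k) :* Z :+ ((con 2 :+ k) :* B :+ (con 1 :+ k) :* A)) refl k A B Z ⟩
    (2 ℕ.+ k) ℕ.* A ℕ.+ (1 ℕ.+ k) ℕ.* Z ℕ.+ ((2 ℕ.+ k) ℕ.* B ℕ.+ (1 ℕ.+ k) ℕ.* A)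
      ≡⟨ cong ((2 ℕ.+ k) ℕ.* A ℕ.+ (1 ℕ.+ k) ℕ.* Z ℕ.+_) (binomial-absorption n (ℕ.suc k)) ⟩
    (2 ℕ.+ k) ℕ.* A ℕ.+ (1 ℕ.+ k) ℕ.* Z ℕ.+ n ℕ.* A
      ≡⟨ solve 4 (λ k A Z n → (con 2 :+ k) :* A :+ (con 1 :+ k) :* Z :+ n :* A
           := (con 1 :+ n) :* A :+ Z :+ ((con 1 :+ k) :* A :+ k :* Z)) refl k A Z n ⟩
    (1 ℕ.+ n) ℕ.* A ℕ.+ Z ℕ.+ ((1 ℕ.+ k) ℕ.* A ℕ.+ k ℕ.* Z)
      ≡⟨ cong ((1 ℕ.+ n) ℕ.* A ℕ.+ Z ℕ.+_) (binomial-absorption n k) ⟩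
    (1 ℕ.+ n) ℕ.* A ℕ.+ Z ℕ.+ n ℕ.* Z
      ≡⟨ solve 3 (λ A Z n → (con 1 :+ n) :* A :+ Z :+ n :* Z := (con 1 :+ n) :* (Z :+ A)) refl A Z n ⟩
    (1 ℕ.+ n) ℕ.* (Z ℕ.+ A) ∎
  where
  open ≡-Reasoning
  open ℕSolver
  Z = n C k
  A = n C ℕ.suc k
  B = n C ℕ.suc (ℕ.suc k)

+-reverse : ∀ i j k → k ℕ.+ (j ℕ.+ (i ℕ.+ 0)) ≡ i ℕ.+ (j ℕ.+ (k ℕ.+ 0))
+-reverse = solve 3 (λ i j k → k :+ (j :+ (i :+ con 0)) := i :+ (j :+ (k :+ con 0))) refl
  where open ℕSolver

sum-map-filter : ∀ {A : Set} {P : Pred A 0ℓ} (P? : Decidable P) (f : A → ℕ) xs →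
  sumᴸ (map f (filter P? xs)) ≡ sumᴸ (map (λ x → if does (P? x) then f x else 0) xs)
sum-map-filter P? f []       = refl
sum-map-filter P? f (x ∷ xs) with does (P? x)
... | true  = cong (f x ℕ.+_) (sum-map-filter P? f xs)
... | false = sum-map-filter P? f xs

-- List sums as iterated sums, and subtraction in 𝔽.

module Moments (p : ℕ) (p-prime : Prime p) where

  open AffineGeometry p p-prime
  open PrimeField p p-prime
  private
    module ℕΣ = VecSum ℕ.+-0-commutativeMonoid p

  sum-tabulate : ∀ {n} (f : Fin n → ℕ) → sumᴸ (tabulate f) ≡ ℕΣ.sum f
  sum-tabulate {ℕ.zero}  f = refl
  sum-tabulate {ℕ.suc n} f = cong (f zero ℕ.+_) (sum-tabulate (f ∘ suc))

  sum-cartesianProductWith : ∀ {A B C : Set} (g : A → B → C) (f : C → ℕ) xs ys →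
    sumᴸ (map f (cartesianProductWith g xs ys)) ≡ sumᴸ (map (λ x → sumᴸ (map (f ∘ g x) ys)) xs)
  sum-cartesianProductWith g f []       ys = refl
  sum-cartesianProductWith g f (x ∷ xs) ys = begin
    sumᴸ (map f (map (g x) ys ++ cartesianProductWith g xs ys))
      ≡⟨ cong sumᴸ (List.map-++ f (map (g x) ys) _) ⟩
    sumᴸ (map f (map (g x) ys) ++ map f (cartesianProductWith g xs ys))
      ≡⟨ sum-++ (map f (map (g x) ys)) _ ⟩
    sumᴸ (map f (map (g x) ys)) ℕ.+ sumᴸ (map f (cartesianProductWith g xs ys))
      ≡⟨ cong₂ ℕ._+_ (cong sumᴸ (sym (List.map-∘ ys))) (sum-cartesianProductWith g f xs ys) ⟩
    sumᴸ (map (f ∘ g x) ys) ℕ.+ sumᴸ (map (λ x → sumᴸ (map (f ∘ g x) ys)) xs) ∎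
    where open ≡-Reasoning

  sum-allVecs : ∀ k (f : Vec 𝔽 k → ℕ) → sumᴸ (map f (allVecs k)) ≡ ℕΣ.∑ⱽ f
  sum-allVecs ℕ.zero    f = ℕ.+-identityʳ _
  sum-allVecs (ℕ.suc k) f = begin
    sumᴸ (map f (allVecs (ℕ.suc k)))
      ≡⟨ sum-cartesianProductWith _∷_ f (allFin p) (allVecs k) ⟩
    sumᴸ (map (λ a → sumᴸ (map (f ∘ (a ∷_)) (allVecs k))) (allFin p))
      ≡⟨ cong sumᴸ (List.map-tabulate (λ a → a) (λ a → sumᴸ (map (f ∘ (a ∷_)) (allVecs k)))) ⟩
    sumᴸ (tabulate (λ a → sumᴸ (map (f ∘ (a ∷_)) (allVecs k))))
      ≡⟨ sum-tabulate (λ a → sumᴸ (map (f ∘ (a ∷_)) (allVecs k))) ⟩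
    ℕΣ.sum (λ a → sumᴸ (map (f ∘ (a ∷_)) (allVecs k)))
      ≡⟨ ℕΣ.sum-cong (λ a → sum-allVecs k (f ∘ (a ∷_))) ⟩
    ℕΣ.∑ⱽ f ∎
    where open ≡-Reasoning

  -1ᶠ : 𝔽
  -1ᶠ = neg 1ᶠ

  -- With a - b written as a + (-1) b, identities linear in each subtraction are semiring identities in the atom -1.
  infixl 6 _-ᶠ_
  _-ᶠ_ : 𝔽 → 𝔽 → 𝔽
  a -ᶠ b = a +ᶠ -1ᶠ *ᶠ b

  a-a≡0 : ∀ a → a -ᶠ a ≡ 0ᶠ
  a-a≡0 a = begin
    a +ᶠ -1ᶠ *ᶠ a         ≡⟨ solve 2 (λ a m → a :+ m :* a := (m :+ con 1) :* a) refl a -1ᶠ ⟩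
    (-1ᶠ +ᶠ 1ᶠ) *ᶠ a      ≡⟨ cong (_*ᶠ a) (neg-inverseˡ 1ᶠ) ⟩
    0ᶠ *ᶠ a               ≡⟨ *ᶠ-zeroˡ a ⟩
    0ᶠ                    ∎
    where open ≡-Reasoning

  a-b+b≡a : ∀ a b → a -ᶠ b +ᶠ b ≡ a
  a-b+b≡a a b = begin
    a -ᶠ b +ᶠ b     ≡⟨ solve 3 (λ a b m → a :+ m :* b :+ b := a :+ (b :+ m :* b)) refl a b -1ᶠ ⟩
    a +ᶠ (b -ᶠ b)   ≡⟨ cong (a +ᶠ_) (a-a≡0 b) ⟩
    a +ᶠ 0ᶠ         ≡⟨ +ᶠ-identityʳ a ⟩
    a               ∎
    where open ≡-Reasoning

  a-b≡0⇒a≡b : ∀ {a b} → a -ᶠ b ≡ 0ᶠ → a ≡ b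
  a-b≡0⇒a≡b {a} {b} eq = trans (sym (a-b+b≡a a b)) (trans (cong (_+ᶠ b) eq) (+ᶠ-identityˡ b))

  -- Polynomial functions of one variable and polarization.

  Δᶠ : 𝔽 → (𝔽 → 𝔽) → 𝔽 → 𝔽
  Δᶠ y q t = q (t +ᶠ y) -ᶠ q t

  -- q behaves like a polynomial of degree at most n whose coefficient of tⁿ is c.
  Leading : ℕ → 𝔽 → (𝔽 → 𝔽) → Set
  Leading ℕ.zero    c q = ∀ t → q t ≡ c
  Leading (ℕ.suc n) c q = ∀ y → Leading n (ι (ℕ.suc n) *ᶠ (c *ᶠ y)) (Δᶠ y q)

  Leading-cong : ∀ n {c c′ q q′} → c ≡ c′ → (∀ t → q t ≡ q′ t) → Leading n c q → Leading n c′ q′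
  Leading-cong ℕ.zero    refl q≗q′ lead t = trans (sym (q≗q′ t)) (lead t)
  Leading-cong (ℕ.suc n) refl q≗q′ lead y =
    Leading-cong n refl (λ t → cong₂ _-ᶠ_ (q≗q′ (t +ᶠ y)) (q≗q′ t)) (lead y)

  Leading-+ : ∀ n {c d q r} → Leading n c q → Leading n d r → Leading n (c +ᶠ d) (λ t → q t +ᶠ r t)
  Leading-+ ℕ.zero    lead lead′ t = cong₂ _+ᶠ_ (lead t) (lead′ t)
  Leading-+ (ℕ.suc n) {c} {d} {q} {r} lead lead′ y = Leading-cong n
    (solve 4 (λ k c d y → k :* (c :* y) :+ k :* (d :* y) := k :* ((c :+ d) :* y)) refl (ι (ℕ.suc n)) c d y)
    (λ t → solve 5 (λ m a b c d → (a :+ m :* b) :+ (c :+ m :* d) := (a :+ c) :+ m :* (b :+ d)) refl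
             -1ᶠ (q (t +ᶠ y)) (q t) (r (t +ᶠ y)) (r t))
    (Leading-+ n (lead y) (lead′ y))

  Leading-scale : ∀ n a {c q} → Leading n c q → Leading n (a *ᶠ c) (λ t → a *ᶠ q t)
  Leading-scale ℕ.zero    a lead t = cong (a *ᶠ_) (lead t)
  Leading-scale (ℕ.suc n) a {c} {q} lead y = Leading-cong n
    (solve 4 (λ k a c y → a :* (k :* (c :* y)) := k :* ((a :* c) :* y)) refl (ι (ℕ.suc n)) a c y)
    (λ t → solve 4 (λ m a b c → a :* (b :+ m :* c) := a :* b :+ m :* (a :* c)) refl -1ᶠ a (q (t +ᶠ y)) (q t))
    (Leading-scale n a (lead y))

  +ᶠ-rotate : ∀ a b c → a +ᶠ b +ᶠ c ≡ a +ᶠ c +ᶠ b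
  +ᶠ-rotate = solve 3 (λ a b c → a :+ b :+ c := a :+ c :+ b) refl

  Leading-shift : ∀ n a {c q} → Leading n c q → Leading n c (λ t → q (t +ᶠ a))
  Leading-shift ℕ.zero    a lead t = lead (t +ᶠ a)
  Leading-shift (ℕ.suc n) a {q = q} lead y =
    Leading-cong n refl (λ t → cong (λ s → q s -ᶠ q (t +ᶠ a)) (+ᶠ-rotate t a y)) (Leading-shift n a (lead y))

  -- Discrete product rule: the difference of `t *ᶠ q t` with step `y` is
  -- `t *ᶠ Δᶠ y q t +ᶠ y *ᶠ q (t +ᶠ y)`. If `q` has degree d, the two parts contribute the
  -- coefficients d c y and c y, which add up to (d + 1) c y.
  Leading-t* : ∀ n {c q} → Leading n c q → Leading (ℕ.suc n) c (λ t → t *ᶠ q t)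
  Leading-t* ℕ.zero {c} {q} lead y t = begin
    (t +ᶠ y) *ᶠ q (t +ᶠ y) -ᶠ t *ᶠ q t  ≡⟨ cong₂ (λ a b → (t +ᶠ y) *ᶠ a -ᶠ t *ᶠ b) (lead _) (lead t) ⟩
    (t +ᶠ y) *ᶠ c -ᶠ t *ᶠ c
      ≡⟨ solve 4 (λ m t y c → (t :+ y) :* c :+ m :* (t :* c) := c :* y :+ (t :* c :+ m :* (t :* c))) refl -1ᶠ t y c ⟩
    c *ᶠ y +ᶠ (t *ᶠ c -ᶠ t *ᶠ c)        ≡⟨ cong (c *ᶠ y +ᶠ_) (a-a≡0 (t *ᶠ c)) ⟩
    c *ᶠ y +ᶠ 0ᶠ                        ≡⟨ +ᶠ-identityʳ _ ⟩
    c *ᶠ y                              ≡⟨ *ᶠ-identityˡ _ ⟨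
    1ᶠ *ᶠ (c *ᶠ y)                      ∎
    where open ≡-Reasoning
  Leading-t* (ℕ.suc n) {c} {q} lead y = Leading-cong (ℕ.suc n) coefficient
    (λ t → solve 5 (λ m t y a b → t :* (a :+ m :* b) :+ y :* a := (t :+ y) :* a :+ m :* (t :* b)) refl
             -1ᶠ t y (q (t +ᶠ y)) (q t))
    (Leading-+ (ℕ.suc n) {ι (ℕ.suc n) *ᶠ (c *ᶠ y)} {y *ᶠ c} (Leading-t* n (lead y))
      (Leading-scale (ℕ.suc n) y {c} (Leading-shift (ℕ.suc n) y {c} {q} lead)))
    where
    open ≡-Reasoning
    coefficient : ι (ℕ.suc n) *ᶠ (c *ᶠ y) +ᶠ y *ᶠ c ≡ ι (2 ℕ.+ n) *ᶠ (c *ᶠ y)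
    coefficient = begin
      ι (ℕ.suc n) *ᶠ (c *ᶠ y) +ᶠ y *ᶠ c
        ≡⟨ cong (ι (ℕ.suc n) *ᶠ (c *ᶠ y) +ᶠ_) (trans (*ᶠ-comm y c) (sym (*ᶠ-identityˡ _))) ⟩
      ι (ℕ.suc n) *ᶠ (c *ᶠ y) +ᶠ 1ᶠ *ᶠ (c *ᶠ y)
        ≡⟨ solve 3 (λ k o z → k :* z :+ o :* z := (o :+ k) :* z) refl (ι (ℕ.suc n)) 1ᶠ (c *ᶠ y) ⟩
      (1ᶠ +ᶠ ι (ℕ.suc n)) *ᶠ (c *ᶠ y)
        ≡⟨ cong (_*ᶠ (c *ᶠ y)) (ι-homo-+ 1 (ℕ.suc n)) ⟨
      ι (2 ℕ.+ n) *ᶠ (c *ᶠ y) ∎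

  power : ℕ → 𝔽 → 𝔽
  power ℕ.zero    t = 1ᶠ
  power (ℕ.suc n) t = t *ᶠ power n t

  Leading-power : ∀ n → Leading n 1ᶠ (power n)
  Leading-power ℕ.zero    t = refl
  Leading-power (ℕ.suc n) = Leading-t* n (Leading-power n)

  ∏ : List 𝔽 → 𝔽
  ∏ = foldr _*ᶠ_ 1ᶠ

  ∏-++ : ∀ xs ys → ∏ (xs ++ ys) ≡ ∏ xs *ᶠ ∏ ys
  ∏-++ []       ys = sym (*ᶠ-identityˡ _)
  ∏-++ (x ∷ xs) ys = trans (cong (x *ᶠ_) (∏-++ xs ys)) (sym (*ᶠ-assoc x (∏ xs) (∏ ys)))

  differences : List 𝔽 → (𝔽 → 𝔽) → 𝔽 → 𝔽
  differences []       q t = q t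
  differences (y ∷ ys) q t = differences ys q (t +ᶠ y) -ᶠ differences ys q t

  -- Difference operators commute. `differences` takes its first step outermost, whereas `Leading`
  -- takes it directly on `q`.
  differences-Δᶠ : ∀ ys y q t → differences ys (Δᶠ y q) t ≡ differences (y ∷ ys) q t
  differences-Δᶠ []       y q t = refl
  differences-Δᶠ (z ∷ ys) y q t = begin
    differences ys (Δᶠ y q) (t +ᶠ z) -ᶠ differences ys (Δᶠ y q) t
      ≡⟨ cong₂ _-ᶠ_ (differences-Δᶠ ys y q (t +ᶠ z)) (differences-Δᶠ ys y q t) ⟩
    (D (t +ᶠ z +ᶠ y) -ᶠ D (t +ᶠ z)) -ᶠ (D (t +ᶠ y) -ᶠ D t)
      ≡⟨ solve 5 (λ m a b c d → (a :+ m :* b) :+ m :* (c :+ m :* d) := (a :+ m :* c) :+ m :* (b :+ m :* d)) refl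
           -1ᶠ (D (t +ᶠ z +ᶠ y)) (D (t +ᶠ z)) (D (t +ᶠ y)) (D t) ⟩
    (D (t +ᶠ z +ᶠ y) -ᶠ D (t +ᶠ y)) -ᶠ (D (t +ᶠ z) -ᶠ D t)
      ≡⟨ cong (λ s → (D s -ᶠ D (t +ᶠ y)) -ᶠ (D (t +ᶠ z) -ᶠ D t)) (+ᶠ-rotate t z y) ⟩
    (D (t +ᶠ y +ᶠ z) -ᶠ D (t +ᶠ y)) -ᶠ (D (t +ᶠ z) -ᶠ D t) ∎
    where
    open ≡-Reasoning
    D = differences ys q

  -- Each difference lowers the degree by one and multiplies the leading coefficient by the degree
  -- and the step. For `q = power n` this is polarization: n! times a product of n elements, written
  -- through n-th powers of their partial sums.
  differences-Leading : ∀ ys {c q} → Leading (length ys) c q → ∀ t →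
    differences ys q t ≡ ι (length ys !) *ᶠ (c *ᶠ ∏ ys)
  differences-Leading [] {c} lead t = trans (lead t) (sym (trans (*ᶠ-identityˡ _) (*ᶠ-identityʳ c)))
  differences-Leading (y ∷ ys) {c} {q} lead t = begin
    differences (y ∷ ys) q t         ≡⟨ differences-Δᶠ ys y q t ⟨
    differences ys (Δᶠ y q) t        ≡⟨ differences-Leading ys (lead y) t ⟩
    ι (n !) *ᶠ (ι (ℕ.suc n) *ᶠ (c *ᶠ y) *ᶠ ∏ ys)
      ≡⟨ solve 5 (λ f k c y π → f :* (k :* (c :* y) :* π) := (k :* f) :* (c :* (y :* π))) refl
           (ι (n !)) (ι (ℕ.suc n)) c y (∏ ys) ⟩
    ι (ℕ.suc n) *ᶠ ι (n !) *ᶠ (c *ᶠ (y *ᶠ ∏ ys))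
      ≡⟨ cong (_*ᶠ (c *ᶠ (y *ᶠ ∏ ys))) (ι-homo-* (ℕ.suc n) (n !)) ⟨
    ι (ℕ.suc n !) *ᶠ (c *ᶠ (y *ᶠ ∏ ys)) ∎
    where
    open ≡-Reasoning
    n = length ys

  ι-!-≢0 : ∀ n → n ℕ.< p → ι (n !) ≢ 0ᶠ
  ι-!-≢0 ℕ.zero    n<p = 1ᶠ≢0ᶠ
  ι-!-≢0 (ℕ.suc n) n<p eq =
    *ᶠ-≢0 (ι-<-≢0 (ℕ.s≤s ℕ.z≤n) n<p) (ι-!-≢0 n (ℕ.<-trans (ℕ.n<1+n n) n<p)) (trans (sym (ι-homo-* (ℕ.suc n) (n !))) eq)

  -- Affine forms and the planes on which they vanish.

  dot : ∀ {k} → Vec 𝔽 k → Vec 𝔽 k → 𝔽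
  dot []      []      = 0ᶠ
  dot (a ∷ α) (x ∷ v) = a *ᶠ x +ᶠ dot α v

  dot-0 : ∀ {k} (v : Vec 𝔽 k) → dot (replicate k 0ᶠ) v ≡ 0ᶠ
  dot-0 []      = refl
  dot-0 (x ∷ v) = trans (cong₂ _+ᶠ_ (*ᶠ-zeroˡ x) (dot-0 v)) (+ᶠ-identityˡ 0ᶠ)

  dot-+ : ∀ {k} (α β v : Vec 𝔽 k) → dot (Vec.zipWith _+ᶠ_ α β) v ≡ dot α v +ᶠ dot β v
  dot-+ []      []      []      = sym (+ᶠ-identityˡ 0ᶠ)
  dot-+ (a ∷ α) (b ∷ β) (x ∷ v) = trans (cong ((a +ᶠ b) *ᶠ x +ᶠ_) (dot-+ α β v))
    (solve 5 (λ a b x s t → (a :+ b) :* x :+ (s :+ t) := (a :* x :+ s) :+ (b :* x :+ t)) refl a b x (dot α v) (dot β v))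

  dot-insertAt : ∀ {k} (α : Vec 𝔽 (ℕ.suc k)) (v : Vec 𝔽 k) i x →
    dot α (insertAt v i x) ≡ lookup α i *ᶠ x +ᶠ dot (removeAt α i) v
  dot-insertAt (a ∷ α)     v       zero    x = refl
  dot-insertAt (a ∷ b ∷ α) (y ∷ v) (suc i) x = trans (cong (a *ᶠ y +ᶠ_) (dot-insertAt (b ∷ α) v i x))
    (solve 3 (λ a b c → a :+ (b :+ c) := b :+ (a :+ c)) refl (a *ᶠ y) _ _)

  pivot : ∀ {k} (v : Vec 𝔽 k) → v ≢ replicate k 0ᶠ → ∃ λ i → lookup v i ≢ 0ᶠ
  pivot []      v≢0 = contradiction refl v≢0
  pivot (a ∷ v) v≢0 with a Fin.≟ 0ᶠ
  ... | no a≢0   = zero , a≢0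
  ... | yes refl with i , vᵢ≢0 ← pivot v (λ { refl → v≢0 refl }) = suc i , vᵢ≢0

  -- `Divisible` speaks of planes given by a point and a basis, so the zero set of `dot α v +ᶠ c`
  -- needs such a presentation. The equation is solved for coordinate `i`; the other two coordinates
  -- are the parameters.
  module Hyperplane (α : Point) (c : 𝔽) (i : Fin 3) (αᵢ≢0 : lookup α i ≢ 0ᶠ) where

    private
      a a⁻¹ β γ b₀ b₁ b₂ : 𝔽
      a   = lookup α i
      a⁻¹ = proj₁ (inverse a αᵢ≢0)
      β   = lookup (removeAt α i) 0F
      γ   = lookup (removeAt α i) 1F
      b₀  = -1ᶠ *ᶠ (a⁻¹ *ᶠ c)
      b₁  = -1ᶠ *ᶠ (a⁻¹ *ᶠ β)
      b₂  = -1ᶠ *ᶠ (a⁻¹ *ᶠ γ)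

      root : ∀ x → x +ᶠ a *ᶠ (-1ᶠ *ᶠ (a⁻¹ *ᶠ x)) ≡ 0ᶠ
      root x = begin
        x +ᶠ a *ᶠ (-1ᶠ *ᶠ (a⁻¹ *ᶠ x))
          ≡⟨ solve 4 (λ a m i x → x :+ a :* (m :* (i :* x)) := x :+ m :* ((i :* a) :* x)) refl a -1ᶠ a⁻¹ x ⟩
        x -ᶠ (a⁻¹ *ᶠ a) *ᶠ x  ≡⟨ cong (λ o → x -ᶠ o *ᶠ x) (proj₂ (inverse a αᵢ≢0)) ⟩
        x -ᶠ 1ᶠ *ᶠ x          ≡⟨ cong (x -ᶠ_) (*ᶠ-identityˡ x) ⟩
        x -ᶠ x                ≡⟨ a-a≡0 x ⟩
        0ᶠ                    ∎
        where open ≡-Reasoning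

      base₀ : Point
      base₀ = insertAt (0ᶠ ∷ 0ᶠ ∷ []) i b₀

      basis₀ : Vec Point 2
      basis₀ = insertAt (1ᶠ ∷ 0ᶠ ∷ []) i b₁ ∷ insertAt (0ᶠ ∷ 1ᶠ ∷ []) i b₂ ∷ []

      zipWith-insertAt : ∀ {k} (u v : Vec 𝔽 k) i x y →
        Vec.zipWith _+ᶠ_ (insertAt u i x) (insertAt v i y) ≡ insertAt (Vec.zipWith _+ᶠ_ u v) i (x +ᶠ y)
      zipWith-insertAt u       v       zero    x y = refl
      zipWith-insertAt (_ ∷ u) (_ ∷ v) (suc i) x y = cong (_ ∷_) (zipWith-insertAt u v i x y)

      insertAt-replicate : ∀ k i → insertAt (replicate k 0ᶠ) i 0ᶠ ≡ replicate (ℕ.suc k) 0ᶠ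
      insertAt-replicate k         zero    = refl
      insertAt-replicate (ℕ.suc k) (suc i) = cong (0ᶠ ∷_) (insertAt-replicate k i)

      coordinate₁ : ∀ s t → s *ᶠ 1ᶠ +ᶠ (t *ᶠ 0ᶠ +ᶠ 0ᶠ) ≡ s
      coordinate₁ = solve 2 (λ s t → s :* con 1 :+ (t :* con 0 :+ con 0) := s) refl

      coordinate₂ : ∀ s t → s *ᶠ 0ᶠ +ᶠ (t *ᶠ 1ᶠ +ᶠ 0ᶠ) ≡ t
      coordinate₂ = solve 2 (λ s t → s :* con 0 :+ (t :* con 1 :+ con 0) := t) refl

      linComb-basis₀ : ∀ s t → linComb (s ∷ t ∷ []) basis₀ ≡ insertAt (s ∷ t ∷ []) i (s *ᶠ b₁ +ᶠ t *ᶠ b₂)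
      linComb-basis₀ s t = begin
        s *ᵛ insertAt (1ᶠ ∷ 0ᶠ ∷ []) i b₁ +ᵛ (t *ᵛ insertAt (0ᶠ ∷ 1ᶠ ∷ []) i b₂ +ᵛ 0ᵛ)
          ≡⟨ cong₂ _+ᵛ_ (Vec.map-insertAt (s *ᶠ_) b₁ (1ᶠ ∷ 0ᶠ ∷ []) i)
               (cong₂ _+ᵛ_ (Vec.map-insertAt (t *ᶠ_) b₂ (0ᶠ ∷ 1ᶠ ∷ []) i) (sym (insertAt-replicate 2 i))) ⟩
        insertAt (s *ᶠ 1ᶠ ∷ s *ᶠ 0ᶠ ∷ []) i (s *ᶠ b₁) +ᵛ
          (insertAt (t *ᶠ 0ᶠ ∷ t *ᶠ 1ᶠ ∷ []) i (t *ᶠ b₂) +ᵛ insertAt (0ᶠ ∷ 0ᶠ ∷ []) i 0ᶠ)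
          ≡⟨ cong (insertAt (s *ᶠ 1ᶠ ∷ s *ᶠ 0ᶠ ∷ []) i (s *ᶠ b₁) +ᵛ_)
               (zipWith-insertAt (t *ᶠ 0ᶠ ∷ t *ᶠ 1ᶠ ∷ []) (0ᶠ ∷ 0ᶠ ∷ []) i (t *ᶠ b₂) 0ᶠ) ⟩
        insertAt (s *ᶠ 1ᶠ ∷ s *ᶠ 0ᶠ ∷ []) i (s *ᶠ b₁) +ᵛ
          insertAt (t *ᶠ 0ᶠ +ᶠ 0ᶠ ∷ t *ᶠ 1ᶠ +ᶠ 0ᶠ ∷ []) i (t *ᶠ b₂ +ᶠ 0ᶠ)
          ≡⟨ zipWith-insertAt (s *ᶠ 1ᶠ ∷ s *ᶠ 0ᶠ ∷ []) _ i (s *ᶠ b₁) _ ⟩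
        insertAt (s *ᶠ 1ᶠ +ᶠ (t *ᶠ 0ᶠ +ᶠ 0ᶠ) ∷ s *ᶠ 0ᶠ +ᶠ (t *ᶠ 1ᶠ +ᶠ 0ᶠ) ∷ []) i (s *ᶠ b₁ +ᶠ (t *ᶠ b₂ +ᶠ 0ᶠ))
          ≡⟨ cong₂ (λ v x → insertAt v i x) (cong₂ (λ x y → x ∷ y ∷ []) (coordinate₁ s t) (coordinate₂ s t))
               (cong (s *ᶠ b₁ +ᶠ_) (+ᶠ-identityʳ _)) ⟩
        insertAt (s ∷ t ∷ []) i (s *ᶠ b₁ +ᶠ t *ᶠ b₂) ∎
        where open ≡-Reasoning

      parametrisation : ∀ s t →
        base₀ +ᵛ linComb (s ∷ t ∷ []) basis₀ ≡ insertAt (s ∷ t ∷ []) i (b₀ +ᶠ (s *ᶠ b₁ +ᶠ t *ᶠ b₂))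
      parametrisation s t = begin
        base₀ +ᵛ linComb (s ∷ t ∷ []) basis₀
          ≡⟨ cong (base₀ +ᵛ_) (linComb-basis₀ s t) ⟩
        base₀ +ᵛ insertAt (s ∷ t ∷ []) i (s *ᶠ b₁ +ᶠ t *ᶠ b₂)
          ≡⟨ zipWith-insertAt (0ᶠ ∷ 0ᶠ ∷ []) (s ∷ t ∷ []) i b₀ _ ⟩
        insertAt (0ᶠ +ᶠ s ∷ 0ᶠ +ᶠ t ∷ []) i (b₀ +ᶠ (s *ᶠ b₁ +ᶠ t *ᶠ b₂))
          ≡⟨ cong (λ v → insertAt v i (b₀ +ᶠ (s *ᶠ b₁ +ᶠ t *ᶠ b₂)))
               (cong₂ (λ x y → x ∷ y ∷ []) (+ᶠ-identityˡ s) (+ᶠ-identityˡ t)) ⟩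
        insertAt (s ∷ t ∷ []) i (b₀ +ᶠ (s *ᶠ b₁ +ᶠ t *ᶠ b₂)) ∎
        where open ≡-Reasoning

    plane : Plane
    plane = record
      { base = base₀
      ; basis = basis₀
      -- Deleting coordinate `i` of a combination gives back its two coefficients.
      ; independent = λ { (s ∷ t ∷ []) eq → begin
          s ∷ t ∷ []                                            ≡⟨ Vec.removeAt-insertAt (s ∷ t ∷ []) i _ ⟨
          removeAt (insertAt (s ∷ t ∷ []) i (s *ᶠ b₁ +ᶠ t *ᶠ b₂)) i
            ≡⟨ cong (λ v → removeAt v i) (trans (sym (linComb-basis₀ s t)) (trans eq (sym (insertAt-replicate 2 i)))) ⟩
          removeAt (insertAt (0ᶠ ∷ 0ᶠ ∷ []) i 0ᶠ) i              ≡⟨ Vec.removeAt-insertAt (0ᶠ ∷ 0ᶠ ∷ []) i 0ᶠ ⟩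
          0ᶠ ∷ 0ᶠ ∷ []                                          ∎ }
      }
      where open ≡-Reasoning

    private
      value : ∀ s t x → dot α (insertAt (s ∷ t ∷ []) i x) +ᶠ c ≡ a *ᶠ x +ᶠ (β *ᶠ s +ᶠ γ *ᶠ t +ᶠ c)
      value s t x = trans (cong (_+ᶠ c) (dot-insertAt α (s ∷ t ∷ []) i x)) (remaining (removeAt α i))
        where
        remaining : ∀ (δ : Vec 𝔽 2) →
          a *ᶠ x +ᶠ dot δ (s ∷ t ∷ []) +ᶠ c ≡ a *ᶠ x +ᶠ (lookup δ 0F *ᶠ s +ᶠ lookup δ 1F *ᶠ t +ᶠ c)
        remaining (δ₁ ∷ δ₂ ∷ []) =
          solve 4 (λ a b d c → a :+ (b :+ (d :+ con 0)) :+ c := a :+ (b :+ d :+ c)) refl (a *ᶠ x) (δ₁ *ᶠ s) (δ₂ *ᶠ t) c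

      value-parametrisation : ∀ s t → a *ᶠ (b₀ +ᶠ (s *ᶠ b₁ +ᶠ t *ᶠ b₂)) +ᶠ (β *ᶠ s +ᶠ γ *ᶠ t +ᶠ c) ≡ 0ᶠ
      value-parametrisation s t = begin
        a *ᶠ (b₀ +ᶠ (s *ᶠ b₁ +ᶠ t *ᶠ b₂)) +ᶠ (β *ᶠ s +ᶠ γ *ᶠ t +ᶠ c)
          ≡⟨ solve 9 (λ a b₀ b₁ b₂ s t β γ c → a :* (b₀ :+ (s :* b₁ :+ t :* b₂)) :+ (β :* s :+ γ :* t :+ c)
               := (c :+ a :* b₀) :+ (s :* (β :+ a :* b₁) :+ t :* (γ :+ a :* b₂))) refl a b₀ b₁ b₂ s t β γ c ⟩
        (c +ᶠ a *ᶠ b₀) +ᶠ (s *ᶠ (β +ᶠ a *ᶠ b₁) +ᶠ t *ᶠ (γ +ᶠ a *ᶠ b₂))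
          ≡⟨ cong₂ _+ᶠ_ (root c) (cong₂ (λ x y → s *ᶠ x +ᶠ t *ᶠ y) (root β) (root γ)) ⟩
        0ᶠ +ᶠ (s *ᶠ 0ᶠ +ᶠ t *ᶠ 0ᶠ)
          ≡⟨ solve 2 (λ s t → con 0 :+ (s :* con 0 :+ t :* con 0) := con 0) refl s t ⟩
        0ᶠ ∎
        where open ≡-Reasoning

    Points-plane : ∀ v → Points plane v ⇔ dot α v +ᶠ c ≡ 0ᶠ
    Points-plane v = mk⇔ to from
      where
      open ≡-Reasoning
      to : Points plane v → dot α v +ᶠ c ≡ 0ᶠ
      to (s ∷ t ∷ [] , refl) = begin
        dot α (base₀ +ᵛ linComb (s ∷ t ∷ []) basis₀) +ᶠ c  ≡⟨ cong (λ u → dot α u +ᶠ c) (parametrisation s t) ⟩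
        dot α (insertAt (s ∷ t ∷ []) i _) +ᶠ c             ≡⟨ value s t _ ⟩
        _                                                  ≡⟨ value-parametrisation s t ⟩
        0ᶠ                                                 ∎

      from : dot α v +ᶠ c ≡ 0ᶠ → Points plane v
      from eq with s ∷ t ∷ [] ← removeAt v i in rest = s ∷ t ∷ [] , (begin
        v                                  ≡⟨ v≡ ⟩
        insertAt (s ∷ t ∷ []) i (lookup v i)
          -- `lookup v i` and the parametrised value solve the same linear equation, whose leading
          -- coefficient `a` is nonzero.
          ≡⟨ cong (insertAt (s ∷ t ∷ []) i) (*ᶠ-cancelˡ a αᵢ≢0 (+ᶠ-cancelʳ _ _ _ (begin
               a *ᶠ lookup v i +ᶠ (β *ᶠ s +ᶠ γ *ᶠ t +ᶠ c)    ≡⟨ value s t (lookup v i) ⟨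
               dot α (insertAt (s ∷ t ∷ []) i (lookup v i)) +ᶠ c  ≡⟨ cong (λ u → dot α u +ᶠ c) v≡ ⟨
               dot α v +ᶠ c                                  ≡⟨ eq ⟩
               0ᶠ                                            ≡⟨ value-parametrisation s t ⟨
               _                                             ∎))) ⟩
        insertAt (s ∷ t ∷ []) i (b₀ +ᶠ (s *ᶠ b₁ +ᶠ t *ᶠ b₂))  ≡⟨ parametrisation s t ⟨
        base₀ +ᵛ linComb (s ∷ t ∷ []) basis₀                 ∎)
        where
        v≡ : v ≡ insertAt (s ∷ t ∷ []) i (lookup v i)
        v≡ = trans (sym (Vec.insertAt-removeAt v i)) (cong (λ u → insertAt u i (lookup v i)) rest)

-- Pairing a divisible multiset with functions of low degree.

module Pairing (p : ℕ) (p-prime : Prime p) where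

  open AffineGeometry p p-prime
  open PrimeField p p-prime
  open Moments p p-prime
  private
    module ℕΣ = VecSum ℕ.+-0-commutativeMonoid p
  open 𝔽Σ using (∑ⱽ; ∑ⱽ-cong; ∑ⱽ-distrib-∙; ∑ⱽ-∑-comm; sum-single; sum-zero)

  Affine : (Point → 𝔽) → Set
  Affine g = ∃₂ λ α c → ∀ v → g v ≡ dot α v +ᶠ c

  Affine-+ : ∀ {g h} → Affine g → Affine h → Affine (λ v → g v +ᶠ h v)
  Affine-+ (α , c , g≡) (β , d , h≡) = α +ᵛ β , c +ᶠ d , λ v → trans (cong₂ _+ᶠ_ (g≡ v) (h≡ v))
    (trans (solve 4 (λ a b c d → (a :+ c) :+ (b :+ d) := (a :+ b) :+ (c :+ d)) refl (dot α v) (dot β v) c d)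
      (cong (_+ᶠ (c +ᶠ d)) (sym (dot-+ α β v))))

  Affine-const : ∀ c → Affine (λ _ → c)
  Affine-const c = 0ᵛ , c , λ v → sym (trans (cong (_+ᶠ c) (dot-0 v)) (+ᶠ-identityˡ c))

  unit : ∀ {k} → Fin k → Vec 𝔽 k
  unit {ℕ.suc k} zero    = 1ᶠ ∷ replicate k 0ᶠ
  unit {ℕ.suc k} (suc i) = 0ᶠ ∷ unit i

  dot-unit : ∀ {k} (i : Fin k) v → dot (unit i) v ≡ lookup v i
  dot-unit zero    (x ∷ v) = trans (cong₂ _+ᶠ_ (*ᶠ-identityˡ x) (dot-0 v)) (+ᶠ-identityʳ x)
  dot-unit (suc i) (x ∷ v) = trans (cong₂ _+ᶠ_ (*ᶠ-zeroˡ x) (dot-unit i v)) (+ᶠ-identityˡ _)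

  Affine-lookup : ∀ i c → Affine (λ v → lookup v i +ᶠ c)
  Affine-lookup i c = unit i , c , λ v → cong (_+ᶠ c) (sym (dot-unit i v))

  binomialⱽ : ∀ {k} → Vec 𝔽 k → Vec 𝔽 k → ℕ
  binomialⱽ []      []      = 1
  binomialⱽ (x ∷ v) (i ∷ t) = (toℕ x C toℕ i) ℕ.* binomialⱽ v t

  degree : ∀ {k} → Vec 𝔽 k → ℕ
  degree []      = 0
  degree (i ∷ t) = toℕ i ℕ.+ degree t

  -- The falling factorial of a coordinate, kept as a list because polarization needs the separate
  -- affine factors.
  fallingFactors : Fin 3 → ℕ → List (Point → 𝔽)
  fallingFactors i ℕ.zero    = []
  fallingFactors i (ℕ.suc m) = (λ v → lookup v i -ᶠ ι m) ∷ fallingFactors i m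

  length-fallingFactors : ∀ i m → length (fallingFactors i m) ≡ m
  length-fallingFactors i ℕ.zero    = refl
  length-fallingFactors i (ℕ.suc m) = cong ℕ.suc (length-fallingFactors i m)

  Affine-fallingFactors : ∀ i m → All Affine (fallingFactors i m)
  Affine-fallingFactors i ℕ.zero    = []
  Affine-fallingFactors i (ℕ.suc m) = Affine-lookup i (-1ᶠ *ᶠ ι m) ∷ Affine-fallingFactors i m

  -- Induction on `m`: the new factor acts by `binomial-absorption` modulo `p`, (x - m) C(x,m) = (m
  -- + 1) C(x,m+1).
  ∏-fallingFactors : ∀ i m v →
    ∏ (map (_$ v) (fallingFactors i m)) ≡ ι (m !) *ᶠ ι (toℕ (lookup v i) C m)
  ∏-fallingFactors i ℕ.zero    v = sym (*ᶠ-identityˡ 1ᶠ)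
  ∏-fallingFactors i (ℕ.suc m) v = begin
    (x -ᶠ ι m) *ᶠ ∏ (map (_$ v) (fallingFactors i m))
      ≡⟨ cong ((x -ᶠ ι m) *ᶠ_) (∏-fallingFactors i m v) ⟩
    (x -ᶠ ι m) *ᶠ (ι (m !) *ᶠ ι (n C m))
      ≡⟨ solve 5 (λ x k m f c → (x :+ m :* k) :* (f :* c) := f :* (x :* c :+ m :* (k :* c))) refl
           x (ι m) -1ᶠ (ι (m !)) (ι (n C m)) ⟩
    ι (m !) *ᶠ (x *ᶠ ι (n C m) -ᶠ ι m *ᶠ ι (n C m))
      ≡⟨ cong (λ y → ι (m !) *ᶠ (y -ᶠ ι m *ᶠ ι (n C m))) absorption ⟩
    ι (m !) *ᶠ ((ι (ℕ.suc m) *ᶠ ι (n C ℕ.suc m) +ᶠ ι m *ᶠ ι (n C m)) -ᶠ ι m *ᶠ ι (n C m))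
      ≡⟨ solve 4 (λ f a b m → f :* (a :+ b :+ m :* b) := f :* (a :+ (b :+ m :* b))) refl
           (ι (m !)) (ι (ℕ.suc m) *ᶠ ι (n C ℕ.suc m)) (ι m *ᶠ ι (n C m)) -1ᶠ ⟩
    ι (m !) *ᶠ (ι (ℕ.suc m) *ᶠ ι (n C ℕ.suc m) +ᶠ (ι m *ᶠ ι (n C m) -ᶠ ι m *ᶠ ι (n C m)))
      ≡⟨ cong (λ y → ι (m !) *ᶠ (ι (ℕ.suc m) *ᶠ ι (n C ℕ.suc m) +ᶠ y)) (a-a≡0 (ι m *ᶠ ι (n C m))) ⟩
    ι (m !) *ᶠ (ι (ℕ.suc m) *ᶠ ι (n C ℕ.suc m) +ᶠ 0ᶠ)
      ≡⟨ solve 3 (λ f s c → f :* (s :* c :+ con 0) := (s :* f) :* c) refl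
           (ι (m !)) (ι (ℕ.suc m)) (ι (n C ℕ.suc m)) ⟩
    ι (ℕ.suc m) *ᶠ ι (m !) *ᶠ ι (n C ℕ.suc m)
      ≡⟨ cong (_*ᶠ ι (n C ℕ.suc m)) (ι-homo-* (ℕ.suc m) (m !)) ⟨
    ι (ℕ.suc m !) *ᶠ ι (n C ℕ.suc m) ∎
    where
    open ≡-Reasoning
    x = lookup v i
    n = toℕ x
    absorption : x *ᶠ ι (n C m) ≡ ι (ℕ.suc m) *ᶠ ι (n C ℕ.suc m) +ᶠ ι m *ᶠ ι (n C m)
    absorption = begin
      x *ᶠ ι (n C m)                 ≡⟨ cong (_*ᶠ ι (n C m)) (ι-toℕ x) ⟨
      ι n *ᶠ ι (n C m)               ≡⟨ ι-homo-* n (n C m) ⟨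
      ι (n ℕ.* (n C m))              ≡⟨ cong ι (binomial-absorption n m) ⟨
      ι (ℕ.suc m ℕ.* (n C ℕ.suc m) ℕ.+ m ℕ.* (n C m))
        ≡⟨ ι-homo-+ (ℕ.suc m ℕ.* (n C ℕ.suc m)) (m ℕ.* (n C m)) ⟩
      ι (ℕ.suc m ℕ.* (n C ℕ.suc m)) +ᶠ ι (m ℕ.* (n C m))
        ≡⟨ cong₂ _+ᶠ_ (ι-homo-* (ℕ.suc m) (n C ℕ.suc m)) (ι-homo-* m (n C m)) ⟩
      ι (ℕ.suc m) *ᶠ ι (n C ℕ.suc m) +ᶠ ι m *ᶠ ι (n C m) ∎

  module _ (w : Point → ℕ) where

    pairing : (Point → 𝔽) → 𝔽
    pairing φ = ∑ⱽ λ v → ι (w v) *ᶠ φ v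

    pairing-cong : ∀ {φ ψ} → (∀ v → φ v ≡ ψ v) → pairing φ ≡ pairing ψ
    pairing-cong φ≗ψ = ∑ⱽ-cong λ v → cong (ι (w v) *ᶠ_) (φ≗ψ v)

    pairing-+ : ∀ φ ψ → pairing (λ v → φ v +ᶠ ψ v) ≡ pairing φ +ᶠ pairing ψ
    pairing-+ φ ψ = trans (∑ⱽ-cong λ v → *ᶠ-distribˡ-+ᶠ (ι (w v)) (φ v) (ψ v))
      (∑ⱽ-distrib-∙ (λ v → ι (w v) *ᶠ φ v) (λ v → ι (w v) *ᶠ ψ v))

    pairing-scale : ∀ a φ → pairing (λ v → a *ᶠ φ v) ≡ a *ᶠ pairing φ
    pairing-scale a φ = sym (trans
      (∑ⱽ-hom 𝔽-+-commutativeMonoid 𝔽-+-commutativeMonoid p (a *ᶠ_) (*ᶠ-zeroʳ a) (*ᶠ-distribˡ-+ᶠ a)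
        (λ v → ι (w v) *ᶠ φ v))
      (∑ⱽ-cong λ v → solve 3 (λ a w x → a :* (w :* x) := w :* (a :* x)) refl a (ι (w v)) (φ v)))

    pairing-sum : ∀ {m} (φ : Fin m → Point → 𝔽) →
      pairing (λ v → 𝔽Σ.sum (λ r → φ r v)) ≡ 𝔽Σ.sum (λ r → pairing (φ r))
    pairing-sum φ = trans
      (∑ⱽ-cong λ v → sum-hom 𝔽-+-commutativeMonoid 𝔽-+-commutativeMonoid p
        (ι (w v) *ᶠ_) (*ᶠ-zeroʳ (ι (w v))) (*ᶠ-distribˡ-+ᶠ (ι (w v))) (λ r → φ r v))
      (∑ⱽ-∑-comm λ v r → ι (w v) *ᶠ φ r v)

    pairing-ι : ∀ f → pairing (ι ∘ f) ≡ ι (ℕΣ.∑ⱽ λ v → w v ℕ.* f v)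
    pairing-ι f = trans (∑ⱽ-cong λ v → sym (ι-homo-* (w v) (f v)))
      (sym (∑ⱽ-hom ℕ.+-0-commutativeMonoid 𝔽-+-commutativeMonoid p ι refl ι-homo-+ (λ v → w v ℕ.* f v)))

    pairing-scale-0 : ∀ a φ → pairing φ ≡ 0ᶠ → pairing (λ v → a *ᶠ φ v) ≡ 0ᶠ
    pairing-scale-0 a φ eq = trans (pairing-scale a φ) (trans (cong (a *ᶠ_) eq) (*ᶠ-zeroʳ a))

    indicator : 𝔽 → 𝔽 → 𝔽
    indicator r a = if does (a Fin.≟ r) then 1ᶠ else 0ᶠ

    indicator-expansion : ∀ (q : 𝔽 → 𝔽) a → q a ≡ 𝔽Σ.sum (λ r → q r *ᶠ indicator r a)
    indicator-expansion q a = sym (trans (sum-single a off) on)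
      where
      off : ∀ r → r ≢ a → q r *ᶠ indicator r a ≡ 0ᶠ
      off r r≢a rewrite dec-false (a Fin.≟ r) (r≢a ∘ sym) = *ᶠ-zeroʳ (q r)
      on : q a *ᶠ indicator a a ≡ q a
      on rewrite dec-true (a Fin.≟ a) refl = *ᶠ-identityʳ (q a)

    module _ (divisible : Divisible w) (p∣total : p ∣ total w) where

      pairing-const : ∀ c → pairing (λ _ → c) ≡ 0ᶠ
      pairing-const c = begin
        pairing (λ _ → c)                     ≡⟨ pairing-cong (λ _ → *ᶠ-identityʳ c) ⟨
        pairing (λ _ → c *ᶠ 1ᶠ)               ≡⟨ pairing-scale-0 c (λ _ → 1ᶠ) (trans (pairing-ι (λ _ → 1)) (∣⇒ι≡0 _ p∣)) ⟩
        0ᶠ                                    ∎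
        where
        open ≡-Reasoning
        p∣ : p ∣ ℕΣ.∑ⱽ λ v → w v ℕ.* 1
        p∣ = subst (p ∣_) (trans (sum-allVecs 3 w) (ℕΣ.∑ⱽ-cong λ v → sym (ℕ.*-identityʳ (w v)))) p∣total

      -- A level set of a nonconstant affine form is a plane, so the pairing is a plane sum of `w`
      -- reduced modulo `p`.
      pairing-plane : ∀ α c i → lookup α i ≢ 0ᶠ → ∀ r → pairing (λ v → indicator r (dot α v +ᶠ c)) ≡ 0ᶠ
      pairing-plane α c i αᵢ≢0 r = begin
        pairing (λ v → indicator r (dot α v +ᶠ c))
          ≡⟨ ∑ⱽ-cong pointwise ⟩
        ∑ⱽ (λ v → ι (if does (points? plane v) then w v else 0))
          ≡⟨ ∑ⱽ-hom ℕ.+-0-commutativeMonoid 𝔽-+-commutativeMonoid p ι refl ι-homo-+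
               (λ v → if does (points? plane v) then w v else 0) ⟨
        ι (ℕΣ.∑ⱽ (λ v → if does (points? plane v) then w v else 0))
          ≡⟨ cong ι (trans (sum-map-filter (points? plane) w points) (sum-allVecs 3 _)) ⟨
        ι (sumOver plane w)
          ≡⟨ ∣⇒ι≡0 _ (divisible plane) ⟩
        0ᶠ ∎
        where
        open ≡-Reasoning
        open Hyperplane α (c -ᶠ r) i αᵢ≢0
        shift : ∀ a → a +ᶠ (c -ᶠ r) ≡ (a +ᶠ c) -ᶠ r
        shift a = sym (+ᶠ-assoc a c (-1ᶠ *ᶠ r))
        same : ∀ v → (dot α v +ᶠ c ≡ r) ⇔ Points plane v
        same v = mk⇔
          (λ eq → Equivalence.from (Points-plane v) (trans (shift (dot α v)) (trans (cong (_-ᶠ r) eq) (a-a≡0 r))))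
          (λ v∈ → a-b≡0⇒a≡b (trans (sym (shift (dot α v))) (Equivalence.to (Points-plane v) v∈)))
        pointwise : ∀ v → ι (w v) *ᶠ indicator r (dot α v +ᶠ c) ≡ ι (if does (points? plane v) then w v else 0)
        pointwise v = begin
          ι (w v) *ᶠ indicator r (dot α v +ᶠ c)
            ≡⟨ cong (λ b → ι (w v) *ᶠ (if b then 1ᶠ else 0ᶠ)) (does-⇔ (same v) (dot α v +ᶠ c Fin.≟ r) (points? plane v)) ⟩
          ι (w v) *ᶠ (if does (points? plane v) then 1ᶠ else 0ᶠ)
            ≡⟨ distribute (does (points? plane v)) ⟩
          ι (if does (points? plane v) then w v else 0) ∎
          where
          distribute : ∀ b → ι (w v) *ᶠ (if b then 1ᶠ else 0ᶠ) ≡ ι (if b then w v else 0)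
          distribute true  = *ᶠ-identityʳ (ι (w v))
          distribute false = *ᶠ-zeroʳ (ι (w v))

      -- A function of one affine form is a combination of the indicators of its level sets. These
      -- are planes unless the form is constant; in that case the divisibility of the total takes
      -- over.
      pairing-affine : ∀ {g} → Affine g → ∀ q → pairing (q ∘ g) ≡ 0ᶠ
      pairing-affine {g} (α , c , g≡) q with Vec.≡-dec Fin._≟_ α 0ᵛ
      ... | yes refl = trans
        (pairing-cong λ v → cong q (trans (g≡ v) (trans (cong (_+ᶠ c) (dot-0 v)) (+ᶠ-identityˡ c))))
        (pairing-const (q c))
      ... | no α≢0 with i , αᵢ≢0 ← pivot α α≢0 = begin
        pairing (q ∘ g)
          ≡⟨ pairing-cong (λ v → trans (cong q (g≡ v)) (indicator-expansion q (dot α v +ᶠ c))) ⟩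
        pairing (λ v → 𝔽Σ.sum λ r → q r *ᶠ indicator r (dot α v +ᶠ c))
          ≡⟨ pairing-sum (λ r v → q r *ᶠ indicator r (dot α v +ᶠ c)) ⟩
        𝔽Σ.sum (λ r → pairing λ v → q r *ᶠ indicator r (dot α v +ᶠ c))
          ≡⟨ sum-zero (λ r → pairing-scale-0 (q r) (λ v → indicator r (dot α v +ᶠ c)) (pairing-plane α c i αᵢ≢0 r)) ⟩
        0ᶠ ∎
        where open ≡-Reasoning

      -- The steps vary with `v`, but each term of the expanded difference is, up to sign, `q` at
      -- the sum of `g` and some of the `gs`, which is again a single affine form.
      pairing-differences : ∀ {gs} → All Affine gs → ∀ {g} → Affine g → ∀ q →
        pairing (λ v → differences (map (_$ v) gs) q (g v)) ≡ 0ᶠ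
      pairing-differences []                      g-aff q = pairing-affine g-aff q
      pairing-differences {h ∷ gs} (h-aff ∷ gs-aff) {g} g-aff q = begin
        pairing (λ v → D v (g v +ᶠ h v) +ᶠ -1ᶠ *ᶠ D v (g v))
          ≡⟨ pairing-+ (λ v → D v (g v +ᶠ h v)) (λ v → -1ᶠ *ᶠ D v (g v)) ⟩
        pairing (λ v → D v (g v +ᶠ h v)) +ᶠ pairing (λ v → -1ᶠ *ᶠ D v (g v))
          ≡⟨ cong₂ _+ᶠ_ (pairing-differences gs-aff (Affine-+ {g} {h} g-aff h-aff) q)
               (pairing-scale-0 -1ᶠ (λ v → D v (g v)) (pairing-differences gs-aff g-aff q)) ⟩
        0ᶠ +ᶠ 0ᶠ
          ≡⟨ +ᶠ-identityˡ 0ᶠ ⟩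
        0ᶠ ∎
        where
        open ≡-Reasoning
        D : Point → 𝔽 → 𝔽
        D v = differences (map (_$ v) gs) q

      -- Polarization rewrites n! times the product as an iterated difference of the n-th power,
      -- which pairs to zero; n! is a unit because n < p.
      pairing-∏ : ∀ {gs} → All Affine gs → length gs ℕ.< p → pairing (λ v → ∏ (map (_$ v) gs)) ≡ 0ᶠ
      pairing-∏ {gs} gs-aff n<p = *ᶠ-≡0 (ι (n !)) (ι-!-≢0 n n<p) (begin
        ι (n !) *ᶠ pairing (λ v → ∏ (map (_$ v) gs))
          ≡⟨ pairing-scale (ι (n !)) (λ v → ∏ (map (_$ v) gs)) ⟨
        pairing (λ v → ι (n !) *ᶠ ∏ (map (_$ v) gs))
          ≡⟨ pairing-cong polarization ⟨
        pairing (λ v → differences (map (_$ v) gs) (power n) 0ᶠ)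
          ≡⟨ pairing-differences gs-aff (Affine-const 0ᶠ) (power n) ⟩
        0ᶠ ∎)
        where
        open ≡-Reasoning
        n = length gs
        polarization : ∀ v → differences (map (_$ v) gs) (power n) 0ᶠ ≡ ι (n !) *ᶠ ∏ (map (_$ v) gs)
        polarization v = begin
          differences (map (_$ v) gs) (power n) 0ᶠ
            ≡⟨ differences-Leading (map (_$ v) gs) {1ᶠ} {power n}
                 (subst (λ m → Leading m 1ᶠ (power n)) (sym (List.length-map (_$ v) gs)) (Leading-power n)) 0ᶠ ⟩
          ι (length (map (_$ v) gs) !) *ᶠ (1ᶠ *ᶠ ∏ (map (_$ v) gs))
            ≡⟨ cong₂ (λ m x → ι (m !) *ᶠ x) (List.length-map (_$ v) gs) (*ᶠ-identityˡ _) ⟩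
          ι (n !) *ᶠ ∏ (map (_$ v) gs) ∎

      -- Multiplied by the unit i! j! k!, the weight becomes a product of `degree t` falling
      -- factors, and `pairing-∏` applies.
      moment : ∀ t → degree t ℕ.< p → p ∣ ℕΣ.∑ⱽ λ v → w v ℕ.* binomialⱽ v t
      moment t@(i ∷ j ∷ k ∷ []) deg<p = ι≡0⇒∣ _ (trans (sym (pairing-ι (λ v → binomialⱽ v t)))
        (*ᶠ-≡0 f f≢0 (trans (sym (pairing-scale f (λ v → ι (binomialⱽ v t))))
          (trans (pairing-cong product) (pairing-∏ {gs} gs-affine (subst (ℕ._< p) (sym length-gs) deg<p))))))
        where
        open ≡-Reasoning
        factors : Fin 3 → 𝔽 → List (Point → 𝔽)
        factors n a = fallingFactors n (toℕ a)
        gs : List (Point → 𝔽)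
        gs = factors 0F i ++ (factors 1F j ++ factors 2F k)
        gs-affine : All Affine gs
        gs-affine = All.++⁺ (Affine-fallingFactors 0F (toℕ i))
          (All.++⁺ (Affine-fallingFactors 1F (toℕ j)) (Affine-fallingFactors 2F (toℕ k)))
        length-gs : length gs ≡ degree t
        length-gs = begin
          length gs
            ≡⟨ List.length-++ (factors 0F i) ⟩
          length (factors 0F i) ℕ.+ length (factors 1F j ++ factors 2F k)
            ≡⟨ cong (length (factors 0F i) ℕ.+_) (List.length-++ (factors 1F j)) ⟩
          length (factors 0F i) ℕ.+ (length (factors 1F j) ℕ.+ length (factors 2F k))
            ≡⟨ cong₂ ℕ._+_ (length-fallingFactors 0F (toℕ i)) (cong₂ ℕ._+_ (length-fallingFactors 1F (toℕ j))
                 (trans (length-fallingFactors 2F (toℕ k)) (sym (ℕ.+-identityʳ (toℕ k))))) ⟩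
          degree t ∎
        f : 𝔽
        f = ι (toℕ i !) *ᶠ (ι (toℕ j !) *ᶠ ι (toℕ k !))
        f≢0 : f ≢ 0ᶠ
        f≢0 = *ᶠ-≢0 (ι-!-≢0 _ (Fin.toℕ<n i)) (*ᶠ-≢0 (ι-!-≢0 _ (Fin.toℕ<n j)) (ι-!-≢0 _ (Fin.toℕ<n k)))
        product : ∀ v → f *ᶠ ι (binomialⱽ v t) ≡ ∏ (map (_$ v) gs)
        product v@(x ∷ y ∷ z ∷ []) = sym (begin
          ∏ (map (_$ v) gs)
            ≡⟨ cong ∏ (trans (List.map-++ (_$ v) (factors 0F i) _)
                 (cong (map (_$ v) (factors 0F i) ++_) (List.map-++ (_$ v) (factors 1F j) _))) ⟩
          ∏ (map (_$ v) (factors 0F i) ++ (map (_$ v) (factors 1F j) ++ map (_$ v) (factors 2F k)))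
            ≡⟨ trans (∏-++ (map (_$ v) (factors 0F i)) _)
                 (cong (∏ (map (_$ v) (factors 0F i)) *ᶠ_) (∏-++ (map (_$ v) (factors 1F j)) _)) ⟩
          ∏ (map (_$ v) (factors 0F i)) *ᶠ (∏ (map (_$ v) (factors 1F j)) *ᶠ ∏ (map (_$ v) (factors 2F k)))
            ≡⟨ cong₂ _*ᶠ_ (∏-fallingFactors 0F (toℕ i) v)
                 (cong₂ _*ᶠ_ (∏-fallingFactors 1F (toℕ j) v) (∏-fallingFactors 2F (toℕ k) v)) ⟩
          ι (toℕ i !) *ᶠ ι a *ᶠ (ι (toℕ j !) *ᶠ ι b *ᶠ (ι (toℕ k !) *ᶠ ι c))
            ≡⟨ solve 6 (λ i a j b k c → i :* a :* (j :* b :* (k :* c)) := (i :* (j :* k)) :* (a :* (b :* c))) refl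
                 (ι (toℕ i !)) (ι a) (ι (toℕ j !)) (ι b) (ι (toℕ k !)) (ι c) ⟩
          f *ᶠ (ι a *ᶠ (ι b *ᶠ ι c))
            ≡⟨ cong (f *ᶠ_) (trans (cong (ι a *ᶠ_) (sym (ι-homo-* b c))) (sym (ι-homo-* a (b ℕ.* c)))) ⟩
          f *ᶠ ι (a ℕ.* (b ℕ.* c))
            ≡⟨ cong (λ n → f *ᶠ ι (a ℕ.* (b ℕ.* n))) (ℕ.*-identityʳ c) ⟨
          f *ᶠ ι (binomialⱽ v t) ∎)
          where
          a = toℕ x C toℕ i
          b = toℕ y C toℕ j
          c = toℕ z C toℕ k

-- Vector identities, then functions whose line sums depend on the direction only.

module LineInvariance (p : ℕ) (p-prime : Prime p) where

  open AffineGeometry p p-prime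
  open PrimeField p p-prime
  open Moments p p-prime
  open Pairing p p-prime
  private
    module ℕΣ = VecSum ℕ.+-0-commutativeMonoid p

  degree≡0⇒≡0 : ∀ {k} (t : Vec 𝔽 k) → degree t ≡ 0 → t ≡ replicate k 0ᶠ
  degree≡0⇒≡0 []      eq = refl
  degree≡0⇒≡0 (i ∷ t) eq = cong₂ _∷_
    (Fin.toℕ-injective (trans (ℕ.m+n≡0⇒m≡0 (toℕ i) eq) (sym toℕ-0ᶠ)))
    (degree≡0⇒≡0 t (ℕ.m+n≡0⇒n≡0 (toℕ i) eq))

  vec₃ : ∀ {a b c a′ b′ c′ : 𝔽} → a ≡ a′ → b ≡ b′ → c ≡ c′ →
    _≡_ {A = Point} (a ∷ b ∷ c ∷ []) (a′ ∷ b′ ∷ c′ ∷ [])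
  vec₃ refl refl refl = refl

  e₁ e₂ e₃ : Point
  e₁ = 1ᶠ ∷ 0ᶠ ∷ 0ᶠ ∷ []
  e₂ = 0ᶠ ∷ 1ᶠ ∷ 0ᶠ ∷ []
  e₃ = 0ᶠ ∷ 0ᶠ ∷ 1ᶠ ∷ []

  -- A twisted step takes the line with base `b` and slope `α` to the one with base `b +ᵛ v` and
  -- slope `α +ᵛ a *ᵛ v`, keeping the parameter `k`.
  +ᵛ-twist : ∀ b k α a v → b +ᵛ k *ᵛ α +ᵛ (1ᶠ +ᶠ k *ᶠ a) *ᵛ v ≡ b +ᵛ v +ᵛ k *ᵛ (α +ᵛ a *ᵛ v)
  +ᵛ-twist (b₁ ∷ b₂ ∷ b₃ ∷ []) k (α₁ ∷ α₂ ∷ α₃ ∷ []) a (v₁ ∷ v₂ ∷ v₃ ∷ []) =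
    vec₃ (twist b₁ α₁ v₁) (twist b₂ α₂ v₂) (twist b₃ α₃ v₃)
    where
    twist : ∀ b α v → b +ᶠ k *ᶠ α +ᶠ (1ᶠ +ᶠ k *ᶠ a) *ᶠ v ≡ b +ᶠ v +ᶠ k *ᶠ (α +ᶠ a *ᶠ v)
    twist b α v =
      solve 5 (λ b k α a v → b :+ k :* α :+ (con 1 :+ k :* a) :* v := b :+ v :+ k :* (α :+ a :* v)) refl b k α a v

  *ᵛ-zeroˡ : ∀ v → 0ᶠ *ᵛ v ≡ 0ᵛ
  *ᵛ-zeroˡ (x ∷ y ∷ z ∷ []) = vec₃ (*ᶠ-zeroˡ x) (*ᶠ-zeroˡ y) (*ᶠ-zeroˡ z)

  *ᵛ-zeroʳ : ∀ k → k *ᵛ 0ᵛ ≡ 0ᵛ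
  *ᵛ-zeroʳ k = vec₃ (*ᶠ-zeroʳ k) (*ᶠ-zeroʳ k) (*ᶠ-zeroʳ k)

  *ᵛ-identityˡ : ∀ v → 1ᶠ *ᵛ v ≡ v
  *ᵛ-identityˡ (x ∷ y ∷ z ∷ []) = vec₃ (*ᶠ-identityˡ x) (*ᶠ-identityˡ y) (*ᶠ-identityˡ z)

  +ᵛ-identityʳ : ∀ v → v +ᵛ 0ᵛ ≡ v
  +ᵛ-identityʳ (x ∷ y ∷ z ∷ []) = vec₃ (+ᶠ-identityʳ x) (+ᶠ-identityʳ y) (+ᶠ-identityʳ z)

  +ᵛ-step : ∀ u n e → u +ᵛ ι (ℕ.suc n) *ᵛ e ≡ u +ᵛ ι n *ᵛ e +ᵛ e
  +ᵛ-step (u₁ ∷ u₂ ∷ u₃ ∷ []) n (x ∷ y ∷ z ∷ []) = vec₃ (step u₁ x) (step u₂ y) (step u₃ z)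
    where
    step : ∀ u x → u +ᶠ ι (ℕ.suc n) *ᶠ x ≡ u +ᶠ ι n *ᶠ x +ᶠ x
    step u x = trans (cong (λ m → u +ᶠ m *ᶠ x) (ι-homo-+ 1 n))
      (solve 3 (λ u n x → u :+ (con 1 :+ n) :* x := u :+ n :* x :+ x) refl u (ι n) x)

  +ᵛ-slope : ∀ b k m v w → b +ᵛ k *ᵛ (v +ᵛ m *ᵛ w) ≡ b +ᵛ k *ᵛ v +ᵛ m *ᵛ (k *ᵛ w)
  +ᵛ-slope (b₁ ∷ b₂ ∷ b₃ ∷ []) k m (v₁ ∷ v₂ ∷ v₃ ∷ []) (w₁ ∷ w₂ ∷ w₃ ∷ []) =
    vec₃ (slope b₁ v₁ w₁) (slope b₂ v₂ w₂) (slope b₃ v₃ w₃)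
    where
    slope : ∀ b v w → b +ᶠ k *ᶠ (v +ᶠ m *ᶠ w) ≡ b +ᶠ k *ᶠ v +ᶠ m *ᶠ (k *ᶠ w)
    slope b v w = solve 5 (λ b k m v w → b :+ k :* (v :+ m :* w) := b :+ k :* v :+ m :* (k :* w)) refl b k m v w

  coordinates : ∀ x y z → 0ᵛ +ᵛ z *ᵛ e₃ +ᵛ y *ᵛ e₂ +ᵛ x *ᵛ e₁ ≡ x ∷ y ∷ z ∷ []
  coordinates x y z = vec₃
    (solve 3 (λ x y z → con 0 :+ z :* con 0 :+ y :* con 0 :+ x :* con 1 := x) refl x y z)
    (solve 3 (λ x y z → con 0 :+ z :* con 0 :+ y :* con 1 :+ x :* con 0 := y) refl x y z)
    (solve 3 (λ x y z → con 0 :+ z :* con 1 :+ y :* con 0 :+ x :* con 0 := z) refl x y z)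

  slope≢0 : ∀ m → e₁ +ᵛ m *ᵛ e₂ ≢ 0ᵛ
  slope≢0 m eq = 1ᶠ≢0ᶠ (trans (solve 1 (λ m → con 1 := con 1 :+ m :* con 0) refl m) (cong (λ v → lookup v 0F) eq))

  scaled-e₂≢0 : ∀ {k} → k ≢ 0ᶠ → k *ᵛ e₂ ≢ 0ᵛ
  scaled-e₂≢0 {k} k≢0 eq = k≢0 (trans (sym (*ᶠ-identityʳ k)) (cong (λ v → lookup v 1F) eq))

  -- `E` stays abstract because it is instantiated twice: modulo differences of parallel lines and
  -- modulo cylinders.
  module _ {ℓ₁ ℓ₂} (E : AbelianGroup ℓ₁ ℓ₂) (h : Point → AbelianGroup.Carrier E) where

    open AbelianGroup E using (Carrier; _≈_; _∙_; ε; _⁻¹; _-_; setoid; ∙-cong; ∙-congˡ; ⁻¹-cong; assoc; identityˡ; identityʳ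
                                    ; commutativeMonoid)
      renaming (refl to ≈-refl; sym to ≈-sym; trans to ≈-trans; reflexive to ≈-reflexive)
    open import Algebra.Properties.AbelianGroup E using (xyx⁻¹≈y; ε⁻¹≈ε; ⁻¹-∙-comm; x∙y⁻¹≈ε⇒x≈y; x≈y⇒x∙y⁻¹≈ε)
    open import Algebra.Properties.CommutativeMonoid.Mult commutativeMonoid
      using (×-congʳ; ×-congˡ; ×-homo-+; ×-distrib-+; ×-assocˡ; ×-homo-1) renaming (_×_ to infixr 7.5 _·_)
    open import Relation.Binary.Reasoning.Setoid setoid
    module EΣ = VecSum commutativeMonoid p
    open EΣ using (sum-syntax; ∑ⱽ; ∑ⱽ-cong; ∑ⱽ-single; ∑ⱽ-comm; sum-cong; sum-single; sum-replicate; ∑-distrib-+; ∑-comm)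

    private
      minus-cong : ∀ {x y x′ y′} → x ≈ x′ → y ≈ y′ → x - y ≈ x′ - y′
      minus-cong x≈x′ y≈y′ = ∙-cong x≈x′ (⁻¹-cong y≈y′)

      h-cong : ∀ {u v} → u ≡ v → h u ≈ h v
      h-cong eq = ≈-reflexive (cong h eq)

    line : Point → Point → Carrier
    line b v = ∑[ k < p ] h (b +ᵛ k *ᵛ v)

    sum-minus : ∀ {n} (f g : Fin n → Carrier) → EΣ.sum (λ i → f i - g i) ≈ EΣ.sum f - EΣ.sum g
    sum-minus f g = ≈-trans (∑-distrib-+ f (λ i → g i ⁻¹))
      (∙-congˡ (≈-sym (sum-hom commutativeMonoid commutativeMonoid p _⁻¹ ε⁻¹≈ε (λ x y → ≈-sym (⁻¹-∙-comm x y)) g)))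

    sum-constant : ∀ x → ∑[ k < p ] x ≈ p · x
    sum-constant x = sum-replicate p

    ×-ε : ∀ n → n · ε ≈ ε
    ×-ε ℕ.zero    = ≈-refl
    ×-ε (ℕ.suc n) = ≈-trans (identityˡ (n · ε)) (×-ε n)

    module _ (line-invariant : ∀ v → v ≢ 0ᵛ → ∀ b b′ → line b v ≈ line b′ v) where

      -- Lines in the p directions e₁ + m e₂ through b together contain b with multiplicity p, and the remaining
      -- points split into the lines {b + k e₁ + m k e₂ : m ∈ 𝔽}, k ≠ 0, of direction e₂.
      torsion : ∀ b b′ → p · h b ≈ p · h b′
      torsion b b′ = x∙y⁻¹≈ε⇒x≈y _ _ (begin
        p · h b - p · h b′
          ≈⟨ minus-cong (column₀ b) (column₀ b′) ⟨
        column 0ᶠ b - column 0ᶠ b′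
          ≈⟨ sum-single {f = λ k → column k b - column k b′} 0ᶠ
               (λ k k≢0 → x≈y⇒x∙y⁻¹≈ε (line-invariant (k *ᵛ e₂) (scaled-e₂≢0 k≢0) (b +ᵛ k *ᵛ e₁) (b′ +ᵛ k *ᵛ e₁))) ⟨
        ∑[ k < p ] (column k b - column k b′)
          ≈⟨ sum-minus (λ k → column k b) (λ k → column k b′) ⟩
        ∑[ k < p ] column k b - ∑[ k < p ] column k b′
          ≈⟨ x≈y⇒x∙y⁻¹≈ε (≈-trans (≈-sym (pencil b))
               (≈-trans (sum-cong λ m → line-invariant (e₁ +ᵛ m *ᵛ e₂) (slope≢0 m) b b′) (pencil b′))) ⟩
        ε ∎)
        where
        column : 𝔽 → Point → Carrier
        column k b = line (b +ᵛ k *ᵛ e₁) (k *ᵛ e₂)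
        column₀ : ∀ b → column 0ᶠ b ≈ p · h b
        column₀ b = ≈-trans (sum-cong λ m → h-cong (trans (cong₂ (λ u v → b +ᵛ u +ᵛ m *ᵛ v) (*ᵛ-zeroˡ e₁) (*ᵛ-zeroˡ e₂))
          (trans (cong₂ _+ᵛ_ (+ᵛ-identityʳ b) (*ᵛ-zeroʳ m)) (+ᵛ-identityʳ b)))) (sum-constant (h b))
        pencil : ∀ b → ∑[ m < p ] line b (e₁ +ᵛ m *ᵛ e₂) ≈ ∑[ k < p ] column k b
        pencil b = ≈-trans (∑-comm λ m k → h (b +ᵛ k *ᵛ (e₁ +ᵛ m *ᵛ e₂)))
          (sum-cong λ k → sum-cong λ m → h-cong (+ᵛ-slope b k m e₁ e₂))

      -- The slopes that accumulate in Djoković's sum may be zero. Such a degenerate line sum is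
      -- `p · h b`, and `torsion` makes it independent of `b`.
      line-invariant₀ : ∀ v b b′ → line b v ≈ line b′ v
      line-invariant₀ v b b′ with v ≟ 0ᵛ
      ... | no v≢0   = line-invariant v v≢0 b b′
      ... | yes refl = ≈-trans (degenerate b) (≈-trans (torsion b b′) (≈-sym (degenerate b′)))
        where
        degenerate : ∀ b → line b 0ᵛ ≈ p · h b
        degenerate b =
          ≈-trans (sum-cong λ k → h-cong (trans (cong (b +ᵛ_) (*ᵛ-zeroʳ k)) (+ᵛ-identityʳ b))) (sum-constant (h b))

      -- Djoković's identity and the vanishing of high differences.

      Δ : List Point → Point → Carrier
      Δ []       u = h u
      Δ (v ∷ vs) u = Δ vs (u +ᵛ v) - Δ vs u

      -- Djoković's twist of Δ vs: the j-th step, counted from the end, is scaled by 1 + k j.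
      twisted : 𝔽 → List Point → Point → Carrier
      twisted k []       u = h u
      twisted k (v ∷ vs) u =
        twisted k vs (u +ᵛ (1ᶠ +ᶠ k *ᶠ ι (length (v ∷ vs))) *ᵛ v) - twisted k vs u

      twisted-0 : ∀ vs u → twisted 0ᶠ vs u ≈ Δ vs u
      twisted-0 []       u = ≈-refl
      twisted-0 (v ∷ vs) u = minus-cong
        (≈-trans (≈-reflexive (cong (λ w → twisted 0ᶠ vs (u +ᵛ w)) (trans (cong (_*ᵛ v) scale) (*ᵛ-identityˡ v))))
          (twisted-0 vs (u +ᵛ v)))
        (twisted-0 vs u)
        where
        scale : 1ᶠ +ᶠ 0ᶠ *ᶠ ι (length (v ∷ vs)) ≡ 1ᶠ
        scale = solve 1 (λ n → con 1 :+ con 0 :* n := con 1) refl (ι (length (v ∷ vs)))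

      -- Expanding twisted k vs (b + kα) yields terms h (b′ + kα′) with b′, α′ independent of k.
      sum-twisted : ∀ vs α b b′ →
        ∑[ k < p ] twisted k vs (b +ᵛ k *ᵛ α) ≈ ∑[ k < p ] twisted k vs (b′ +ᵛ k *ᵛ α)
      sum-twisted []       α b b′ = line-invariant₀ α b b′
      sum-twisted (v ∷ vs) α b b′ = begin
        ∑[ k < p ] twisted k (v ∷ vs) (b +ᵛ k *ᵛ α)   ≈⟨ expand b ⟩
        T (b +ᵛ v) (α +ᵛ a *ᵛ v) - T b α
          ≈⟨ minus-cong (sum-twisted vs (α +ᵛ a *ᵛ v) (b +ᵛ v) (b′ +ᵛ v)) (sum-twisted vs α b b′) ⟩
        T (b′ +ᵛ v) (α +ᵛ a *ᵛ v) - T b′ α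
          ≈⟨ expand b′ ⟨
        ∑[ k < p ] twisted k (v ∷ vs) (b′ +ᵛ k *ᵛ α)  ∎
        where
        a = ι (length (v ∷ vs))
        T : Point → Point → Carrier
        T b α = ∑[ k < p ] twisted k vs (b +ᵛ k *ᵛ α)
        expand : ∀ b → ∑[ k < p ] twisted k (v ∷ vs) (b +ᵛ k *ᵛ α) ≈ T (b +ᵛ v) (α +ᵛ a *ᵛ v) - T b α
        expand b = ≈-trans
          (sum-cong λ k → minus-cong (≈-reflexive (cong (twisted k vs) (+ᵛ-twist b k α a v))) ≈-refl)
          (sum-minus (λ k → twisted k vs (b +ᵛ v +ᵛ k *ᵛ (α +ᵛ a *ᵛ v))) (λ k → twisted k vs (b +ᵛ k *ᵛ α)))

      -- The difference numbered `n` has step zero, hence is zero everywhere, and the differences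
      -- outside it act on the zero function.
      twisted-vanishes : ∀ k vs n → 0 ℕ.< n → n ℕ.≤ length vs → 1ᶠ +ᶠ k *ᶠ ι n ≡ 0ᶠ → ∀ u → twisted k vs u ≈ ε
      twisted-vanishes k []       n 0<n n≤0 eq u = contradiction n≤0 (ℕ.<⇒≱ 0<n)
      twisted-vanishes k (v ∷ vs) n 0<n n≤  eq u with n ℕ.≟ length (v ∷ vs)
      ... | yes refl = x≈y⇒x∙y⁻¹≈ε (≈-reflexive (cong (twisted k vs)
              (trans (cong (u +ᵛ_) (trans (cong (_*ᵛ v) eq) (*ᵛ-zeroˡ v))) (+ᵛ-identityʳ u))))
      ... | no n≢    = x≈y⇒x∙y⁻¹≈ε (≈-trans (vanish _) (≈-sym (vanish u)))
        where
        vanish : ∀ u → twisted k vs u ≈ ε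
        vanish = twisted-vanishes k vs n 0<n (ℕ.s≤s⁻¹ (ℕ.≤∧≢⇒< n≤ n≢)) eq

      -- `n` represents -1/k. It lies between 1 and p - 1, so p - 1 twisted steps are just enough to
      -- contain it for each nonzero `k`.
      opposite-inverse : ∀ k → k ≢ 0ᶠ → ∃ λ n → 0 ℕ.< n × n ℕ.< p × 1ᶠ +ᶠ k *ᶠ ι n ≡ 0ᶠ
      opposite-inverse k k≢0 = toℕ a , ℕ.n≢0⇒n>0 toℕa≢0 , Fin.toℕ<n a , root
        where
        a : 𝔽
        a = -1ᶠ *ᶠ proj₁ (inverse k k≢0)
        root : 1ᶠ +ᶠ k *ᶠ ι (toℕ a) ≡ 0ᶠ
        root = trans (cong (λ x → 1ᶠ +ᶠ k *ᶠ x) (ι-toℕ a))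
          (trans (solve 3 (λ k m i → con 1 :+ k :* (m :* i) := con 1 :+ m :* (i :* k)) refl k -1ᶠ (proj₁ (inverse k k≢0)))
            (trans (cong (1ᶠ -ᶠ_) (proj₂ (inverse k k≢0))) (a-a≡0 1ᶠ)))
        toℕa≢0 : toℕ a ≢ 0
        toℕa≢0 eq = 1ᶠ≢0ᶠ (trans (solve 1 (λ k → con 1 := con 1 :+ k :* con 0) refl k)
          (trans (cong (λ n → 1ᶠ +ᶠ k *ᶠ ι n) (sym eq)) root))

      Δ-constant : ∀ vs → ℕ.suc (length vs) ≡ p → ∀ b b′ → Δ vs b ≈ Δ vs b′
      -- Starting with slope `0ᵛ` keeps the base point at `b` for every `k`; slopes then arise from
      -- the twists alone.
      Δ-constant vs len b b′ = ≈-trans (≈-sym (as-sum b)) (≈-trans (sum-twisted vs 0ᵛ b b′) (as-sum b′))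
        where
        as-sum : ∀ b → ∑[ k < p ] twisted k vs (b +ᵛ k *ᵛ 0ᵛ) ≈ Δ vs b
        as-sum b = begin
          ∑[ k < p ] twisted k vs (b +ᵛ k *ᵛ 0ᵛ)
            ≈⟨ sum-single {f = λ k → twisted k vs (b +ᵛ k *ᵛ 0ᵛ)} 0ᶠ (λ k k≢0 →
                 let n , 0<n , n<p , eq = opposite-inverse k k≢0
                 in twisted-vanishes k vs n 0<n (ℕ.s≤s⁻¹ (subst (n ℕ.<_) (sym len) n<p)) eq _) ⟩
          twisted 0ᶠ vs (b +ᵛ 0ᶠ *ᵛ 0ᵛ)
            ≡⟨ cong (twisted 0ᶠ vs) (trans (cong (b +ᵛ_) (*ᵛ-zeroʳ 0ᶠ)) (+ᵛ-identityʳ b)) ⟩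
          twisted 0ᶠ vs b
            ≈⟨ twisted-0 vs b ⟩
          Δ vs b ∎

      Δ-vanishes : ∀ vs → p ℕ.≤ length vs → ∀ u → Δ vs u ≈ ε
      Δ-vanishes []       p≤0 u = contradiction (ℕ.≤-trans 1<p p≤0) λ ()
      Δ-vanishes (v ∷ vs) p≤  u with p ℕ.≟ ℕ.suc (length vs)
      ... | yes p≡ = x≈y⇒x∙y⁻¹≈ε (Δ-constant vs (sym p≡) (u +ᵛ v) u)
      ... | no p≢  = x≈y⇒x∙y⁻¹≈ε (≈-trans (vanish (u +ᵛ v)) (≈-sym (vanish u)))
        where
        vanish : ∀ u → Δ vs u ≈ ε
        vanish = Δ-vanishes vs (ℕ.s≤s⁻¹ (ℕ.≤∧≢⇒< p≤ p≢))

      ·-minus : ∀ n x y → n · (x - y) ≈ n · x - n · y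
      ·-minus n x y = ≈-trans (×-distrib-+ x (y ⁻¹) n) (∙-congˡ (negate n))
        where
        negate : ∀ n → n · y ⁻¹ ≈ (n · y) ⁻¹
        negate ℕ.zero    = ≈-sym ε⁻¹≈ε
        negate (ℕ.suc n) = ≈-trans (∙-congˡ (negate n)) (⁻¹-∙-comm y (n · y))

      -- Multiplication by `p` commutes with differences, and `p · h` is constant by `torsion`.
      torsion-Δ : ∀ vs b b′ → p · Δ vs b ≈ p · Δ vs b′
      torsion-Δ []       b b′ = torsion b b′
      torsion-Δ (v ∷ vs) b b′ = ≈-trans (vanish b) (≈-sym (vanish b′))
        where
        vanish : ∀ b → p · Δ (v ∷ vs) b ≈ ε
        vanish b = ≈-trans (·-minus p (Δ vs (b +ᵛ v)) (Δ vs b)) (x≈y⇒x∙y⁻¹≈ε (torsion-Δ vs (b +ᵛ v) b))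

      p·Δ : ∀ vs → length vs ≢ 0 → ∀ u → p · Δ vs u ≈ ε
      p·Δ []       ≢0 u = contradiction refl ≢0
      p·Δ (v ∷ vs) _  u = ≈-trans (·-minus p (Δ vs (u +ᵛ v)) (Δ vs u)) (x≈y⇒x∙y⁻¹≈ε (torsion-Δ vs (u +ᵛ v) u))

      -- Newton expansion and the evaluation of weighted sums.

      Δ^ : Point → ℕ → List Point → Point → Carrier
      Δ^ e i vs = Δ (List.replicate i e ++ vs)

      Δ^-∷ : ∀ e i vs u → Δ^ e i (e ∷ vs) u ≈ Δ^ e (ℕ.suc i) vs u
      Δ^-∷ e i vs u = ≈-reflexive (cong (λ xs → Δ xs u) (shift i))
        where
        shift : ∀ i → List.replicate i e ++ e ∷ vs ≡ e ∷ List.replicate i e ++ vs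
        shift ℕ.zero    = refl
        shift (ℕ.suc i) = cong (e ∷_) (shift i)

      -- Induction on `n` by Pascal's rule. Any bound above `n` serves, since C(n,i) = 0 for i > n;
      -- the bound `p` gives all points the common index set 𝔽.
      newton : ∀ e N n → n ℕ.< N → ∀ vs u →
        Δ vs (u +ᵛ ι n *ᵛ e) ≈ ∑[ i < N ] ((n C toℕ i) · Δ^ e (toℕ i) vs u)
      newton e (ℕ.suc N) ℕ.zero n<N vs u = begin
        Δ vs (u +ᵛ 0ᶠ *ᵛ e)   ≡⟨ cong (Δ vs) (trans (cong (u +ᵛ_) (*ᵛ-zeroˡ e)) (+ᵛ-identityʳ u)) ⟩
        Δ vs u                ≈⟨ ×-homo-1 (Δ vs u) ⟨
        1 · Δ vs u            ≈⟨ identityʳ _ ⟨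
        1 · Δ vs u ∙ ε        ≈⟨ ∙-congˡ (EΣ.sum-zero {N} λ i → ≈-refl) ⟨
        ∑[ i < ℕ.suc N ] ((0 C toℕ i) · Δ^ e (toℕ i) vs u) ∎
      newton e (ℕ.suc N) (ℕ.suc n) n<N vs u = begin
        Δ vs (u +ᵛ ι (ℕ.suc n) *ᵛ e)   ≡⟨ cong (Δ vs) (+ᵛ-step u n e) ⟩
        Δ vs (u′ +ᵛ e)                 ≈⟨ xyx⁻¹≈y (Δ vs u′) (Δ vs (u′ +ᵛ e)) ⟨
        Δ vs u′ ∙ Δ vs (u′ +ᵛ e) ∙ Δ vs u′ ⁻¹  ≈⟨ assoc _ _ _ ⟩
        Δ vs u′ ∙ Δ (e ∷ vs) u′
          -- The second expansion has bound `N`: its term `i` carries one extra step `e` and so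
          -- lands on index `i + 1`.
          ≈⟨ ∙-cong (newton e (ℕ.suc N) n (ℕ.<-trans (ℕ.n<1+n n) n<N) vs u) (newton e N n (ℕ.s<s⁻¹ n<N) (e ∷ vs) u) ⟩
        (1 · Δ vs u ∙ ∑[ i < N ] upper i) ∙ ∑[ i < N ] ((n C toℕ i) · Δ^ e (toℕ i) (e ∷ vs) u)
          ≈⟨ assoc _ _ _ ⟩
        1 · Δ vs u ∙ (∑[ i < N ] upper i ∙ ∑[ i < N ] ((n C toℕ i) · Δ^ e (toℕ i) (e ∷ vs) u))
          ≈⟨ ∙-congˡ (∑-distrib-+ upper (λ i → (n C toℕ i) · Δ^ e (toℕ i) (e ∷ vs) u)) ⟨
        1 · Δ vs u ∙ ∑[ i < N ] (upper i ∙ (n C toℕ i) · Δ^ e (toℕ i) (e ∷ vs) u)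
          ≈⟨ ∙-congˡ (sum-cong {N} pascal) ⟩
        ∑[ i < ℕ.suc N ] ((ℕ.suc n C toℕ i) · Δ^ e (toℕ i) vs u) ∎
        where
        u′ = u +ᵛ ι n *ᵛ e
        upper : Fin N → Carrier
        upper i = (n C ℕ.suc (toℕ i)) · Δ^ e (ℕ.suc (toℕ i)) vs u
        pascal : ∀ i → upper i ∙ (n C toℕ i) · Δ^ e (toℕ i) (e ∷ vs) u
          ≈ (ℕ.suc n C ℕ.suc (toℕ i)) · Δ^ e (ℕ.suc (toℕ i)) vs u
        pascal i = begin
          upper i ∙ (n C toℕ i) · Δ^ e (toℕ i) (e ∷ vs) u   ≈⟨ ∙-congˡ (×-congʳ (n C toℕ i) (Δ^-∷ e (toℕ i) vs u)) ⟩
          (n C ℕ.suc (toℕ i)) · D ∙ (n C toℕ i) · D        ≈⟨ ×-homo-+ D (n C ℕ.suc (toℕ i)) (n C toℕ i) ⟨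
          ((n C ℕ.suc (toℕ i)) ℕ.+ (n C toℕ i)) · D
            ≈⟨ ×-congˡ (trans (ℕ.+-comm (n C ℕ.suc (toℕ i)) (n C toℕ i)) (nCk+nC[k+1]≡[n+1]C[k+1] n (toℕ i))) ⟩
          (ℕ.suc n C ℕ.suc (toℕ i)) · D ∎
          where
          D = Δ^ e (ℕ.suc (toℕ i)) vs u

      -- The order in which `newtonⱽ` produces the steps: it expands along `e₁`, `e₂`, `e₃` in turn
      -- and prepends each time.
      steps : Point → List Point
      steps (i ∷ j ∷ k ∷ []) =
        List.replicate (toℕ k) e₃ ++ (List.replicate (toℕ j) e₂ ++ (List.replicate (toℕ i) e₁ ++ []))

      length-steps : ∀ t → length (steps t) ≡ degree t
      length-steps (i ∷ j ∷ k ∷ [])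
        rewrite List.length-++ (List.replicate (toℕ k) e₃) {List.replicate (toℕ j) e₂ ++ (List.replicate (toℕ i) e₁ ++ [])}
              | List.length-++ (List.replicate (toℕ j) e₂) {List.replicate (toℕ i) e₁ ++ []}
              | List.length-++ (List.replicate (toℕ i) e₁) {[]}
              | List.length-replicate (toℕ k) {e₃} | List.length-replicate (toℕ j) {e₂} | List.length-replicate (toℕ i) {e₁}
        = +-reverse (toℕ i) (toℕ j) (toℕ k)

      ·-distrib-sum : ∀ n {m} (f : Fin m → Carrier) → n · EΣ.sum f ≈ EΣ.sum (λ i → n · f i)
      ·-distrib-sum n = sum-hom commutativeMonoid commutativeMonoid p (n ·_) (×-ε n) (λ x y → ×-distrib-+ x y n)

      ·-distrib-∑ⱽ : ∀ n {m} (f : Vec 𝔽 m → Carrier) → n · ∑ⱽ f ≈ ∑ⱽ (λ v → n · f v)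
      ·-distrib-∑ⱽ n = ∑ⱽ-hom commutativeMonoid commutativeMonoid p (n ·_) (×-ε n) (λ x y → ×-distrib-+ x y n)

      newtonⱽ : ∀ v → h v ≈ ∑ⱽ λ t → binomialⱽ v t · Δ (steps t) 0ᵛ
      newtonⱽ (x ∷ y ∷ z ∷ []) = begin
        h (x ∷ y ∷ z ∷ [])
          ≡⟨ cong h (trans (cong₂ _∷_ (ι-toℕ x) (cong₂ (λ y z → y ∷ z ∷ []) (ι-toℕ y) (ι-toℕ z))) refl) ⟨
        h (ι (toℕ x) ∷ ι (toℕ y) ∷ ι (toℕ z) ∷ [])
          ≡⟨ cong h (coordinates (ι (toℕ x)) (ι (toℕ y)) (ι (toℕ z))) ⟨
        h (0ᵛ +ᵛ ι (toℕ z) *ᵛ e₃ +ᵛ ι (toℕ y) *ᵛ e₂ +ᵛ ι (toℕ x) *ᵛ e₁)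
          ≈⟨ newton e₁ p (toℕ x) (Fin.toℕ<n x) [] (0ᵛ +ᵛ ι (toℕ z) *ᵛ e₃ +ᵛ ι (toℕ y) *ᵛ e₂) ⟩
        ∑[ i < p ] (a i · Δ (L₁ i) (0ᵛ +ᵛ ι (toℕ z) *ᵛ e₃ +ᵛ ι (toℕ y) *ᵛ e₂))
          ≈⟨ sum-cong (λ i → ×-congʳ (a i) (≈-trans
               (newton e₂ p (toℕ y) (Fin.toℕ<n y) (L₁ i) (0ᵛ +ᵛ ι (toℕ z) *ᵛ e₃))
               (sum-cong λ j → ×-congʳ (b j) (newton e₃ p (toℕ z) (Fin.toℕ<n z) (L₂ i j) 0ᵛ)))) ⟩
        ∑[ i < p ] (a i · (∑[ j < p ] (b j · (∑[ k < p ] (c k · D i j k)))))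
          ≈⟨ sum-cong (λ i → ≈-trans (·-distrib-sum (a i) (λ j → b j · (∑[ k < p ] (c k · D i j k))))
               (sum-cong λ j → ≈-trans (×-congʳ (a i) (·-distrib-sum (b j) (λ k → c k · D i j k)))
                 (≈-trans (·-distrib-sum (a i) (λ k → b j · (c k · D i j k)))
                   (sum-cong λ k → collect (a i) (b j) (c k) (D i j k))))) ⟩
        ∑ⱽ (λ t → binomialⱽ (x ∷ y ∷ z ∷ []) t · Δ (steps t) 0ᵛ) ∎
        where
        a b c : 𝔽 → ℕ
        a i = toℕ x C toℕ i
        b j = toℕ y C toℕ j
        c k = toℕ z C toℕ k
        L₁ : 𝔽 → List Point
        L₁ i = List.replicate (toℕ i) e₁ ++ []
        L₂ : 𝔽 → 𝔽 → List Point
        L₂ i j = List.replicate (toℕ j) e₂ ++ L₁ i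
        D : 𝔽 → 𝔽 → 𝔽 → Carrier
        D i j k = Δ (List.replicate (toℕ k) e₃ ++ L₂ i j) 0ᵛ
        collect : ∀ a b c x → a · (b · (c · x)) ≈ (a ℕ.* (b ℕ.* (c ℕ.* 1))) · x
        collect a b c x = begin
          a · (b · (c · x))                  ≈⟨ ×-congʳ a (×-assocˡ x b c) ⟩
          a · ((b ℕ.* c) · x)                ≈⟨ ×-assocˡ x a (b ℕ.* c) ⟩
          (a ℕ.* (b ℕ.* c)) · x              ≡⟨ cong (λ n → (a ℕ.* (b ℕ.* n)) · x) (ℕ.*-identityʳ c) ⟨
          (a ℕ.* (b ℕ.* (c ℕ.* 1))) · x      ∎

      -- All the lines may be moved to `0ᵛ`. The resulting `p` copies of one line give `p · h` at
      -- each of its `p` points, and `torsion` moves those to `0ᵛ` as well.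
      sum-lines : ∀ v (b : 𝔽 → Point) → ∑[ s < p ] line (b s) v ≈ p ^ 2 · h 0ᵛ
      sum-lines v b = begin
        ∑[ s < p ] line (b s) v                     ≈⟨ sum-cong (λ s → line-invariant₀ v (b s) 0ᵛ) ⟩
        ∑[ s < p ] line 0ᵛ v                        ≈⟨ sum-constant (line 0ᵛ v) ⟩
        p · line 0ᵛ v                               ≈⟨ ·-distrib-sum p (λ k → h (0ᵛ +ᵛ k *ᵛ v)) ⟩
        ∑[ k < p ] (p · h (0ᵛ +ᵛ k *ᵛ v))           ≈⟨ sum-cong (λ k → torsion (0ᵛ +ᵛ k *ᵛ v) 0ᵛ) ⟩
        ∑[ k < p ] (p · h 0ᵛ)                       ≈⟨ sum-constant (p · h 0ᵛ) ⟩
        p · (p · h 0ᵛ)                              ≈⟨ ×-assocˡ (h 0ᵛ) p p ⟩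
        (p ℕ.* p) · h 0ᵛ                            ≡⟨ cong (λ n → (p ℕ.* n) · h 0ᵛ) (ℕ.*-identityʳ p) ⟨
        p ^ 2 · h 0ᵛ                                ∎

      weighted-sum : ∀ w → Divisible w → p ∣ total w → ∑ⱽ (λ v → w v · h v) ≈ total w · h 0ᵛ
      weighted-sum w divisible p∣total = begin
        ∑ⱽ (λ v → w v · h v)
          ≈⟨ ∑ⱽ-cong (λ v → ≈-trans (×-congʳ (w v) (newtonⱽ v)) (≈-trans (·-distrib-∑ⱽ (w v) (λ t → binomialⱽ v t · D t))
               (∑ⱽ-cong λ t → ×-assocˡ (D t) (w v) (binomialⱽ v t)))) ⟩
        ∑ⱽ (λ v → ∑ⱽ λ t → (w v ℕ.* binomialⱽ v t) · D t)
          ≈⟨ ∑ⱽ-comm (λ v t → (w v ℕ.* binomialⱽ v t) · D t) ⟩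
        ∑ⱽ (λ t → ∑ⱽ λ v → (w v ℕ.* binomialⱽ v t) · D t)
          ≈⟨ ∑ⱽ-cong (λ t → ∑ⱽ-hom ℕ.+-0-commutativeMonoid commutativeMonoid p
               (_· D t) ≈-refl (×-homo-+ (D t)) (λ v → w v ℕ.* binomialⱽ v t)) ⟨
        ∑ⱽ (λ t → N t · D t)
          ≈⟨ ∑ⱽ-single {f = λ t → N t · D t} 0ᵛ vanish ⟩
        N 0ᵛ · D 0ᵛ
          ≈⟨ ≈-reflexive (cong₂ _·_ N-0 D-0) ⟩
        total w · h 0ᵛ ∎
        where
        D : Point → Carrier
        D t = Δ (steps t) 0ᵛ
        N : Point → ℕ
        N t = ℕΣ.∑ⱽ λ v → w v ℕ.* binomialⱽ v t
        vanish : ∀ t → t ≢ 0ᵛ → N t · D t ≈ ε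
        vanish t t≢0 with degree t ℕ.<? p
        ... | no deg≮p  = ≈-trans
          (×-congʳ (N t) (Δ-vanishes (steps t) (subst (p ℕ.≤_) (sym (length-steps t)) (ℕ.≮⇒≥ deg≮p)) 0ᵛ)) (×-ε (N t))
        ... | yes deg<p with divides q N≡ ← moment w divisible p∣total t deg<p = begin
          N t · D t          ≡⟨ cong (_· D t) N≡ ⟩
          (q ℕ.* p) · D t    ≈⟨ ×-assocˡ (D t) q p ⟨
          q · (p · D t)
            ≈⟨ ×-congʳ q (p·Δ (steps t) (λ len≡0 → t≢0 (degree≡0⇒≡0 t (trans (sym (length-steps t)) len≡0))) 0ᵛ) ⟩
          q · ε              ≈⟨ ×-ε q ⟩
          ε                  ∎
        D-0 : D 0ᵛ ≡ h 0ᵛ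
        D-0 = cong (λ n → Δ (List.replicate n e₃ ++ (List.replicate n e₂ ++ (List.replicate n e₁ ++ []))) 0ᵛ) toℕ-0ᶠ
        binomial-0 : ∀ {k} (v : Vec 𝔽 k) → binomialⱽ v (replicate k 0ᶠ) ≡ 1
        binomial-0 []      = refl
        binomial-0 (x ∷ v) = cong₂ ℕ._*_ (cong (toℕ x C_) toℕ-0ᶠ) (binomial-0 v)
        N-0 : N 0ᵛ ≡ total w
        N-0 = trans (ℕΣ.∑ⱽ-cong λ v → trans (cong (w v ℕ.*_) (binomial-0 v)) (ℕ.*-identityʳ (w v))) (sym (sum-allVecs 3 w))

-- The group of integer functions modulo a span.

module SpanQuotient (p : ℕ) (p-prime : Prime p) {I : Set} (g : I → AffineGeometry.Point p p-prime → ℤ) where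

  open AffineGeometry p p-prime

  private
    combination : List (ℤ × I) → Point → ℤ
    combination terms x = foldr ℤ._+_ 0ℤ (map (λ (c , i) → c ℤ.* g i x) terms)

    combination-++ : ∀ ts us x → combination (ts ++ us) x ≡ combination ts x ℤ.+ combination us x
    combination-++ []             us x = sym (ℤ.+-identityˡ _)
    combination-++ ((c , i) ∷ ts) us x =
      trans (cong (λ z → c ℤ.* g i x ℤ.+ z) (combination-++ ts us x)) (sym (ℤ.+-assoc (c ℤ.* g i x) _ _))

    negated : List (ℤ × I) → List (ℤ × I)
    negated = map λ (c , i) → ℤ.- c , i

    combination-negated : ∀ ts x → combination (negated ts) x ≡ ℤ.- combination ts x
    combination-negated []             x = refl
    combination-negated ((c , i) ∷ ts) x = trans
      (cong₂ ℤ._+_ (sym (ℤ.neg-distribˡ-* c (g i x))) (combination-negated ts x))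
      (sym (ℤ.neg-distrib-+ (c ℤ.* g i x) (combination ts x)))

  Span-cong : ∀ {f f′} → (∀ x → f x ≡ f′ x) → f ∈Spanℤ g → f′ ∈Spanℤ g
  Span-cong f≗f′ (ts , eq) = ts , λ x → trans (sym (f≗f′ x)) (eq x)

  Span-+ : ∀ {f f′} → f ∈Spanℤ g → f′ ∈Spanℤ g → (λ x → f x ℤ.+ f′ x) ∈Spanℤ g
  Span-+ (ts , eq) (us , eq′) = ts ++ us , λ x → trans (cong₂ ℤ._+_ (eq x) (eq′ x)) (sym (combination-++ ts us x))

  Span-neg : ∀ {f} → f ∈Spanℤ g → (λ x → ℤ.- f x) ∈Spanℤ g
  Span-neg (ts , eq) = negated ts , λ x → trans (cong ℤ.-_ (eq x)) (sym (combination-negated ts x))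

  Span-generator : ∀ i → g i ∈Spanℤ g
  Span-generator i = (1ℤ , i) ∷ [] , λ x → sym (trans (ℤ.+-identityʳ _) (ℤ.*-identityˡ (g i x)))

  -- A record, so that f and f′ can be inferred from f ≈ f′.
  infix 4 _≈_
  record _≈_ (f f′ : Point → ℤ) : Set where
    constructor congruent
    field difference∈Span : f -ᵐ f′ ∈Spanℤ g

  open _≈_ public

  ≗⇒≈ : ∀ {f f′} → (∀ x → f x ≡ f′ x) → f ≈ f′
  ≗⇒≈ f≗f′ = congruent ([] , λ x → ℤ.i≡j⇒i-j≡0 (f≗f′ x))

  private
    telescope : ∀ a b c → (a ℤ.- b) ℤ.+ (b ℤ.- c) ≡ a ℤ.- c
    telescope = solve 3 (λ a b c → (a :- b) :+ (b :- c) := a :- c) refl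
      where open Data.Integer.Solver.+-*-Solver

    interchange : ∀ a b c d → (a ℤ.- b) ℤ.+ (c ℤ.- d) ≡ (a ℤ.+ c) ℤ.- (b ℤ.+ d)
    interchange = solve 4 (λ a b c d → (a :- b) :+ (c :- d) := (a :+ c) :- (b :+ d)) refl
      where open Data.Integer.Solver.+-*-Solver

    negation : ∀ a b → ℤ.- (a ℤ.- b) ≡ b ℤ.- a
    negation = solve 2 (λ a b → :- (a :- b) := b :- a) refl
      where open Data.Integer.Solver.+-*-Solver

    negations : ∀ a b → ℤ.- (a ℤ.- b) ≡ ℤ.- a ℤ.- ℤ.- b
    negations = solve 2 (λ a b → :- (a :- b) := :- a :- :- b) refl
      where open Data.Integer.Solver.+-*-Solver

  quotientGroup : AbelianGroup 0ℓ 0ℓ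
  quotientGroup = record
    { Carrier = Point → ℤ
    ; _≈_ = _≈_
    ; _∙_ = λ f f′ x → f x ℤ.+ f′ x
    ; ε = λ _ → 0ℤ
    ; _⁻¹ = λ f x → ℤ.- f x
    ; isAbelianGroup = record
      { isGroup = record
        { isMonoid = record
          { isSemigroup = record
            { isMagma = record
              { isEquivalence = record
                { refl = ≗⇒≈ λ _ → refl
                ; sym = λ {f} {f′} (congruent f≈f′) → congruent (Span-cong (λ x → negation (f x) (f′ x)) (Span-neg f≈f′))
                ; trans = λ {f} {f′} {f″} (congruent f≈f′) (congruent f′≈f″) →
                    congruent (Span-cong (λ x → telescope (f x) (f′ x) (f″ x)) (Span-+ f≈f′ f′≈f″)) }
              ; ∙-cong = λ {f} {f′} {h} {h′} (congruent f≈f′) (congruent h≈h′) →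
                  congruent (Span-cong (λ x → interchange (f x) (f′ x) (h x) (h′ x)) (Span-+ f≈f′ h≈h′)) }
            ; assoc = λ f f′ f″ → ≗⇒≈ λ x → ℤ.+-assoc (f x) (f′ x) (f″ x) }
          ; identity = (λ f → ≗⇒≈ λ x → ℤ.+-identityˡ (f x)) , (λ f → ≗⇒≈ λ x → ℤ.+-identityʳ (f x)) }
        ; inverse = (λ f → ≗⇒≈ λ x → ℤ.+-inverseˡ (f x)) , (λ f → ≗⇒≈ λ x → ℤ.+-inverseʳ (f x))
        ; ⁻¹-cong = λ {f} {f′} (congruent f≈f′) → congruent (Span-cong (λ x → negations (f x) (f′ x)) (Span-neg f≈f′)) }
      ; comm = λ f f′ → ≗⇒≈ λ x → ℤ.+-comm (f x) (f′ x) } }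

-- Characteristic functions as sums of point indicators.

module Indicators (p : ℕ) (p-prime : Prime p) where

  open AffineGeometry p p-prime
  open PrimeField p p-prime
  open Moments p p-prime
  open LineInvariance p p-prime using (vec₃; +ᵛ-identityʳ)
  module ℤΣ = VecSum ℤ.+-0-commutativeMonoid p

  δ : Point → Point → ℤ
  δ v x = if does (x ≟ v) then 1ℤ else 0ℤ

  δ-≡ : ∀ {v x} → x ≡ v → δ v x ≡ 1ℤ
  δ-≡ {v} {x} eq rewrite dec-true (x ≟ v) eq = refl

  δ-≢ : ∀ {v x} → x ≢ v → δ v x ≡ 0ℤ
  δ-≢ {v} {x} neq rewrite dec-false (x ≟ v) neq = refl

  𝟙-∈ : ∀ {X : Pred Point 0ℓ} (X? : Decidable X) {x} → X x → 𝟙 X? x ≡ 1ℤ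
  𝟙-∈ X? {x} x∈ rewrite dec-true (X? x) x∈ = refl

  𝟙-∉ : ∀ {X : Pred Point 0ℓ} (X? : Decidable X) {x} → (X x → ⊥) → 𝟙 X? x ≡ 0ℤ
  𝟙-∉ X? {x} x∉ rewrite dec-false (X? x) x∉ = refl

  +ᵛ-cancelʳ : ∀ (u v w : Point) → v +ᵛ u ≡ w +ᵛ u → v ≡ w
  +ᵛ-cancelʳ (a ∷ b ∷ c ∷ []) (a₁ ∷ b₁ ∷ c₁ ∷ []) (a₂ ∷ b₂ ∷ c₂ ∷ []) eq = vec₃
    (+ᶠ-cancelʳ a a₁ a₂ (cong (λ v → lookup v 0F) eq))
    (+ᶠ-cancelʳ b b₁ b₂ (cong (λ v → lookup v 1F) eq))
    (+ᶠ-cancelʳ c c₁ c₂ (cong (λ v → lookup v 2F) eq))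

  +ᵛ-comm : ∀ u v → u +ᵛ v ≡ v +ᵛ u
  +ᵛ-comm = Vec.zipWith-comm +ᶠ-comm

  +ᵛ-assoc : ∀ u v w → (u +ᵛ v) +ᵛ w ≡ u +ᵛ (v +ᵛ w)
  +ᵛ-assoc = Vec.zipWith-assoc +ᶠ-assoc

  +ᵛ-cancelˡ : ∀ (u v w : Point) → u +ᵛ v ≡ u +ᵛ w → v ≡ w
  +ᵛ-cancelˡ u v w eq = +ᵛ-cancelʳ u v w (trans (+ᵛ-comm v u) (trans eq (+ᵛ-comm u w)))

  linComb-+ : ∀ {k} (cs ds : Vec 𝔽 k) (vs : Vec Point k) →
    linComb (Vec.zipWith _+ᶠ_ cs ds) vs ≡ linComb cs vs +ᵛ linComb ds vs
  linComb-+ []       []       []       = sym (+ᵛ-identityʳ 0ᵛ)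
  linComb-+ (c ∷ cs) (d ∷ ds) (v ∷ vs) = trans
    (cong ((c +ᶠ d) *ᵛ v +ᵛ_) (linComb-+ cs ds vs)) (regroup v (linComb cs vs) (linComb ds vs))
    where
    component : ∀ x a b → (c +ᶠ d) *ᶠ x +ᶠ (a +ᶠ b) ≡ (c *ᶠ x +ᶠ a) +ᶠ (d *ᶠ x +ᶠ b)
    component x a b = solve 5 (λ c d x a b → (c :+ d) :* x :+ (a :+ b) := (c :* x :+ a) :+ (d :* x :+ b)) refl c d x a b
    regroup : ∀ v a b → (c +ᶠ d) *ᵛ v +ᵛ (a +ᵛ b) ≡ (c *ᵛ v +ᵛ a) +ᵛ (d *ᵛ v +ᵛ b)
    regroup (x ∷ y ∷ z ∷ []) (a₁ ∷ a₂ ∷ a₃ ∷ []) (b₁ ∷ b₂ ∷ b₃ ∷ []) =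
      vec₃ (component x a₁ b₁) (component y a₂ b₂) (component z a₃ b₃)

  parametrisation-injective : ∀ {k} (S : AffineSubspace k) cs ds →
    base S +ᵛ linComb cs (basis S) ≡ base S +ᵛ linComb ds (basis S) → cs ≡ ds
  parametrisation-injective {k} S cs ds eq = begin
    cs                                    ≡⟨ difference-+ cs ds ⟨
    Vec.zipWith _+ᶠ_ (cs ∸ ds) ds         ≡⟨ cong (λ es → Vec.zipWith _+ᶠ_ es ds) cs∸ds≡0 ⟩
    Vec.zipWith _+ᶠ_ (replicate k 0ᶠ) ds  ≡⟨ Vec.zipWith-identityˡ +ᶠ-identityˡ ds ⟩
    ds                                    ∎
    where
    open ≡-Reasoning
    _∸_ : ∀ {k} → Vec 𝔽 k → Vec 𝔽 k → Vec 𝔽 k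
    _∸_ = Vec.zipWith _-ᶠ_
    difference-+ : ∀ {k} (cs ds : Vec 𝔽 k) → Vec.zipWith _+ᶠ_ (cs ∸ ds) ds ≡ cs
    difference-+ []       []       = refl
    difference-+ (c ∷ cs) (d ∷ ds) = cong₂ _∷_ (a-b+b≡a c d) (difference-+ cs ds)
    cs∸ds≡0 : cs ∸ ds ≡ replicate k 0ᶠ
    cs∸ds≡0 = independent S (cs ∸ ds) (+ᵛ-cancelʳ (linComb ds (basis S)) _ _ (begin
      linComb (cs ∸ ds) (basis S) +ᵛ linComb ds (basis S)  ≡⟨ linComb-+ (cs ∸ ds) ds (basis S) ⟨
      linComb (Vec.zipWith _+ᶠ_ (cs ∸ ds) ds) (basis S)    ≡⟨ cong (λ es → linComb es (basis S)) (difference-+ cs ds) ⟩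
      linComb cs (basis S)                                 ≡⟨ +ᵛ-cancelˡ (base S) _ _ eq ⟩
      linComb ds (basis S)                                 ≡⟨ trans (+ᵛ-comm 0ᵛ _) (+ᵛ-identityʳ _) ⟨
      0ᵛ +ᵛ linComb ds (basis S)                           ∎))

  -- Independence of the basis makes the parametrisation injective, so each point of the subspace is
  -- counted exactly once.
  𝟙-points : ∀ {k} (S : AffineSubspace k) x →
    𝟙 (points? S) x ≡ ℤΣ.∑ⱽ λ cs → δ (base S +ᵛ linComb cs (basis S)) x
  𝟙-points S x = decide (points? S x)
    where
    decide : Dec (Points S x) → 𝟙 (points? S) x ≡ ℤΣ.∑ⱽ λ cs → δ (base S +ᵛ linComb cs (basis S)) x
    decide (yes (cs , x≡)) = trans (𝟙-∈ (points? S) (cs , x≡)) (sym (trans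
      (ℤΣ.∑ⱽ-single {f = λ ds → δ (base S +ᵛ linComb ds (basis S)) x} cs
        λ ds ds≢cs → δ-≢ λ x≡′ → ds≢cs (parametrisation-injective S ds cs (trans (sym x≡′) x≡)))
      (δ-≡ x≡)))
    decide (no x∉) = trans (𝟙-∉ (points? S) x∉)
      (sym (ℤΣ.∑ⱽ-zero {f = λ ds → δ (base S +ᵛ linComb ds (basis S)) x} λ ds → δ-≢ λ x≡ → x∉ (ds , x≡)))

  -- By disjointness at most one summand is 1.
  𝟙ᶜ-lines : ∀ Y x → 𝟙ᶜ Y x ≡ ℤΣ.sum λ k → 𝟙 (points? (lines Y k)) x
  𝟙ᶜ-lines Y x = decide (union? Y x)
    where
    decide : Dec (Union Y x) → 𝟙ᶜ Y x ≡ ℤΣ.sum λ k → 𝟙 (points? (lines Y k)) x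
    decide (yes (k , x∈)) = trans (𝟙-∈ (union? Y) (k , x∈)) (sym (trans
      (ℤΣ.sum-single {f = λ j → 𝟙 (points? (lines Y j)) x} k
        λ j j≢k → 𝟙-∉ (points? (lines Y j)) λ x∈′ → disjoint Y j k j≢k (x∈′ , x∈))
      (𝟙-∈ (points? (lines Y k)) x∈)))
    decide (no x∉) = trans (𝟙-∉ (union? Y) x∉)
      (sym (ℤΣ.sum-zero {f = λ j → 𝟙 (points? (lines Y j)) x} λ j → 𝟙-∉ (points? (lines Y j)) λ x∈ → x∉ (j , x∈)))

  lineThrough : ∀ (b v : Point) → v ≢ 0ᵛ → Line
  lineThrough b v v≢0 = record { base = b ; basis = v ∷ [] ; independent = independent₁ }
    where
    independent₁ : LinearlyIndependent (v ∷ [])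
    independent₁ (k ∷ []) eq with i , vᵢ≢0 ← pivot v v≢0 = cong (_∷ []) (*ᶠ-≡0 (lookup v i) vᵢ≢0 (begin
      lookup v i *ᶠ k       ≡⟨ *ᶠ-comm (lookup v i) k ⟩
      k *ᶠ lookup v i       ≡⟨ Vec.lookup-map i (k *ᶠ_) v ⟨
      lookup (k *ᵛ v) i     ≡⟨ cong (λ u → lookup u i) (trans (sym (+ᵛ-identityʳ (k *ᵛ v))) eq) ⟩
      lookup 0ᵛ i           ≡⟨ Vec.lookup-replicate i 0ᶠ ⟩
      0ᶠ                    ∎))
      where open ≡-Reasoning

  𝟙-lineThrough : ∀ b v v≢0 x → 𝟙 (points? (lineThrough b v v≢0)) x ≡ ℤΣ.sum λ k → δ (b +ᵛ k *ᵛ v) x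
  𝟙-lineThrough b v v≢0 x = trans (𝟙-points (lineThrough b v v≢0) x)
    (ℤΣ.sum-cong λ k → cong (λ u → δ (b +ᵛ u) x) (+ᵛ-identityʳ (k *ᵛ v)))

-- The abstract argument inside a quotient by a span.

module Quotient (p : ℕ) (p-prime : Prime p) {I : Set} (g : I → AffineGeometry.Point p p-prime → ℤ) where

  open AffineGeometry p p-prime
  open Indicators p p-prime
  open SpanQuotient p p-prime g public
  private
    module LI = LineInvariance p p-prime
  open AbelianGroup quotientGroup public using ()
    renaming (commutativeMonoid to quotientMonoid; sym to ≈-sym; trans to ≈-trans)
  open import Algebra.Properties.CommutativeMonoid.Mult quotientMonoid public using () renaming (_×_ to infixr 7.5 _·_)
  module QΣ = VecSum quotientMonoid p

  line : Point → Point → Point → ℤ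
  line = LI.line quotientGroup δ

  -- Evaluation at `x` is not well defined on classes, but the group operations are pointwise on
  -- representatives. `sum-hom` applies because it asks only for additivity on representatives.
  sum-apply : ∀ {n} (f : Fin n → Point → ℤ) x → QΣ.sum f x ≡ ℤΣ.sum λ i → f i x
  sum-apply f x = sum-hom quotientMonoid ℤ.+-0-commutativeMonoid p (λ f → f x) refl (λ _ _ → refl) f

  ∑ⱽ-apply : ∀ {k} (f : Vec 𝔽 k → Point → ℤ) x → QΣ.∑ⱽ f x ≡ ℤΣ.∑ⱽ λ v → f v x
  ∑ⱽ-apply f x = ∑ⱽ-hom quotientMonoid ℤ.+-0-commutativeMonoid p (λ f → f x) refl (λ _ _ → refl) f

  ·-apply : ∀ n (f : Point → ℤ) x → (n · f) x ≡ ℤ.+ n ℤ.* f x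
  ·-apply ℕ.zero    f x = sym (ℤ.*-zeroˡ (f x))
  ·-apply (ℕ.suc n) f x = trans (cong (λ z → f x ℤ.+ z) (·-apply n f x)) (sym (ℤ.suc-* (ℤ.+ n) (f x)))

  line-apply : ∀ b v v≢0 x → line b v x ≡ 𝟙 (points? (lineThrough b v v≢0)) x
  line-apply b v v≢0 x =
    trans (sum-apply (λ k → δ (b +ᵛ k *ᵛ v)) x) (sym (𝟙-lineThrough b v v≢0 x))

  toℤ-expansion : ∀ w → toℤ w ≈ QΣ.∑ⱽ λ v → w v · δ v
  toℤ-expansion w = ≗⇒≈ λ x → sym (begin
    QΣ.∑ⱽ (λ v → w v · δ v) x               ≡⟨ ∑ⱽ-apply (λ v → w v · δ v) x ⟩
    ℤΣ.∑ⱽ (λ v → (w v · δ v) x)             ≡⟨ ℤΣ.∑ⱽ-cong (λ v → ·-apply (w v) (δ v) x) ⟩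
    ℤΣ.∑ⱽ (λ v → ℤ.+ w v ℤ.* δ v x)
      ≡⟨ ℤΣ.∑ⱽ-single {f = λ v → ℤ.+ w v ℤ.* δ v x} x
           (λ v v≢x → trans (cong (ℤ.+ w v ℤ.*_) (δ-≢ (v≢x ∘ sym))) (ℤ.*-zeroʳ (ℤ.+ w v))) ⟩
    ℤ.+ w x ℤ.* δ x x                       ≡⟨ cong (ℤ.+ w x ℤ.*_) (δ-≡ {x} refl) ⟩
    ℤ.+ w x ℤ.* 1ℤ                          ≡⟨ ℤ.*-identityʳ (ℤ.+ w x) ⟩
    ℤ.+ w x                                 ∎)
    where open ≡-Reasoning

  module _ (line-invariant : ∀ v → v ≢ 0ᵛ → ∀ b b′ → line b v ≈ line b′ v) where

    divisible≈ : ∀ w → Divisible w → total w ≡ p ^ 2 → toℤ w ≈ p ^ 2 · δ 0ᵛ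
    divisible≈ w divisible total≡ = ≈-trans (toℤ-expansion w)
      (subst (λ n → QΣ.∑ⱽ (λ v → w v · δ v) ≈ n · δ 0ᵛ) total≡
        (LI.weighted-sum quotientGroup δ line-invariant w divisible
          (subst (p ∣_) (sym total≡) (m∣m*n (p ℕ.* 1)))))

    lines≈ : ∀ v (b : 𝔽 → Point) → QΣ.sum (λ s → line (b s) v) ≈ p ^ 2 · δ 0ᵛ
    lines≈ = LI.sum-lines quotientGroup δ line-invariant

-- Planes modulo differences of parallel lines.

module PlaneCongruence (p : ℕ) (p-prime : Prime p) where

  open AffineGeometry p p-prime
  open Indicators p p-prime
  open LineInvariance p p-prime using (+ᵛ-identityʳ)
  open Quotient p p-prime lineDifference

  -- The difference of the two sides is itself a generator.
  line-invariant : ∀ v → v ≢ 0ᵛ → ∀ b b′ → line b v ≈ line b′ v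
  line-invariant v v≢0 b b′ = congruent (Span-cong
    (λ x → cong₂ ℤ._-_ (sym (line-apply b v v≢0 x)) (sym (line-apply b′ v v≢0 x)))
    (Span-generator (lineThrough b v v≢0 , lineThrough b′ v v≢0 , (λ z → z) , (λ z → z))))

  -- A plane is the union of `p` parallel lines in the direction of its second basis vector, and
  -- `lines≈` evaluates any such family.
  𝟙ᴾ≈ : ∀ H → 𝟙ᴾ H ≈ p ^ 2 · δ 0ᵛ
  𝟙ᴾ≈ H@record { basis = u ∷ v ∷ [] } = ≈-trans (≗⇒≈ as-lines) (lines≈ line-invariant v (λ s → base H +ᵛ s *ᵛ u))
    where
    open ≡-Reasoning
    as-lines : ∀ x → 𝟙ᴾ H x ≡ QΣ.sum (λ s → line (base H +ᵛ s *ᵛ u) v) x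
    as-lines x = begin
      𝟙ᴾ H x
        ≡⟨ 𝟙-points H x ⟩
      ℤΣ.sum (λ s → ℤΣ.sum λ t → δ (base H +ᵛ (s *ᵛ u +ᵛ (t *ᵛ v +ᵛ 0ᵛ))) x)
        ≡⟨ ℤΣ.sum-cong (λ s → ℤΣ.sum-cong λ t → cong (λ z → δ z x) (regroup s t)) ⟩
      ℤΣ.sum (λ s → ℤΣ.sum λ t → δ (base H +ᵛ s *ᵛ u +ᵛ t *ᵛ v) x)
        ≡⟨ ℤΣ.sum-cong (λ s → sum-apply (λ t → δ (base H +ᵛ s *ᵛ u +ᵛ t *ᵛ v)) x) ⟨
      ℤΣ.sum (λ s → line (base H +ᵛ s *ᵛ u) v x)
        ≡⟨ sum-apply (λ s → line (base H +ᵛ s *ᵛ u) v) x ⟨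
      QΣ.sum (λ s → line (base H +ᵛ s *ᵛ u) v) x ∎
      where
      regroup : ∀ s t → base H +ᵛ (s *ᵛ u +ᵛ (t *ᵛ v +ᵛ 0ᵛ)) ≡ base H +ᵛ s *ᵛ u +ᵛ t *ᵛ v
      regroup s t = trans (cong (λ z → base H +ᵛ (s *ᵛ u +ᵛ z)) (+ᵛ-identityʳ (t *ᵛ v)))
        (sym (+ᵛ-assoc (base H) (s *ᵛ u) (t *ᵛ v)))

  divisible-𝟙ᴾ : ∀ w → Divisible w → total w ≡ p ^ 2 → ∀ H → toℤ w -ᵐ 𝟙ᴾ H ∈Spanℤ lineDifference
  divisible-𝟙ᴾ w divisible total≡ H =
    difference∈Span (≈-trans (divisible≈ line-invariant w divisible total≡) (≈-sym (𝟙ᴾ≈ H)))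

-- Parallel lines and divisible multisets modulo cylinders.

module CylinderCongruence (p : ℕ) (p-prime : Prime p) where

  open AffineGeometry p p-prime
  open PrimeField p p-prime
  open Moments p p-prime
  open Indicators p p-prime
  open LineInvariance p p-prime using (vec₃; +ᵛ-identityʳ; e₁; sum-minus)
  open Quotient p p-prime 𝟙ᶜ
  open AbelianGroup quotientGroup using (ε; _-_; setoid; ∙-cong; ⁻¹-cong; reflexive)
  open import Algebra.Properties.AbelianGroup quotientGroup using (ε⁻¹≈ε; x∙y⁻¹≈ε⇒x≈y; x≈y⇒x∙y⁻¹≈ε)

  ∈Span⇒≈ε : ∀ {f} → f ∈Spanℤ 𝟙ᶜ → f ≈ ε
  ∈Span⇒≈ε f∈ = congruent (Span-cong (λ x → sym (ℤ.+-identityʳ _)) f∈)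

  ≈ε⇒∈Span : ∀ {f} → f ≈ ε → f ∈Spanℤ 𝟙ᶜ
  ≈ε⇒∈Span (congruent f∈) = Span-cong (λ x → ℤ.+-identityʳ _) f∈

  -- A vector v with vᵢ ≠ 0 meets each coset of ⟨v⟩ in exactly one point with vanishing i-th coordinate.
  module Transversal (v : Point) (v≢0 : v ≢ 0ᵛ) (i : Fin 3) (vᵢ≢0 : lookup v i ≢ 0ᶠ) where

    lookup-+* : ∀ b k → lookup (b +ᵛ k *ᵛ v) i ≡ lookup b i +ᶠ k *ᶠ lookup v i
    lookup-+* b k = trans (Vec.lookup-zipWith _+ᶠ_ i b (k *ᵛ v)) (cong (lookup b i +ᶠ_) (Vec.lookup-map i (k *ᶠ_) v))

    cylinder : (c : 𝔽 → Point) → (∀ k → lookup (c k) i ≡ 0ᶠ) → (∀ j k → c j ≡ c k → j ≡ k) → Cylinder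
    cylinder c cᵢ≡0 c-injective = record
      { lines    = λ k → lineThrough (c k) v v≢0
      ; parallel = λ _ _ → (λ z → z) , (λ z → z)
      ; disjoint = λ { j k j≢k (((s ∷ []) , x≡) , ((t ∷ []) , x≡′)) → j≢k (c-injective j k (meet j k s t
          (trans (sym (cong (c j +ᵛ_) (+ᵛ-identityʳ (s *ᵛ v))))
            (trans (sym x≡) (trans x≡′ (cong (c k +ᵛ_) (+ᵛ-identityʳ (t *ᵛ v)))))))) }
      }
      where
      open ≡-Reasoning
      meet : ∀ j k s t → c j +ᵛ s *ᵛ v ≡ c k +ᵛ t *ᵛ v → c j ≡ c k
      meet j k s t eq = +ᵛ-cancelʳ (s *ᵛ v) (c j) (c k) (trans eq (cong (λ r → c k +ᵛ r *ᵛ v) (sym s≡t)))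
        where
        a = lookup v i
        at : ∀ j s → lookup (c j +ᵛ s *ᵛ v) i ≡ a *ᶠ s
        at j s = trans (lookup-+* (c j) s) (trans (cong (_+ᶠ s *ᶠ a) (cᵢ≡0 j)) (trans (+ᶠ-identityˡ _) (*ᶠ-comm s a)))
        s≡t : s ≡ t
        s≡t = *ᶠ-cancelˡ a vᵢ≢0 (trans (sym (at j s)) (trans (cong (λ u → lookup u i) eq) (at k t)))

    cylinder≈ε : ∀ c → (∀ k → lookup (c k) i ≡ 0ᶠ) → (∀ j k → c j ≡ c k → j ≡ k) → QΣ.sum (λ k → line (c k) v) ≈ ε
    cylinder≈ε c cᵢ≡0 c-injective = ∈Span⇒≈ε (Span-cong as-lines (Span-generator Y))
      where
      Y = cylinder c cᵢ≡0 c-injective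
      as-lines : ∀ x → 𝟙ᶜ Y x ≡ QΣ.sum (λ k → line (c k) v) x
      as-lines x = trans (𝟙ᶜ-lines Y x) (trans
        (ℤΣ.sum-cong λ k → sym (line-apply (c k) v v≢0 x))
        (sym (sum-apply (λ k → line (c k) v) x)))

    point : 𝔽 × 𝔽 → Point
    point (s , t) = insertAt (s ∷ t ∷ []) i 0ᶠ

    point-injective : ∀ {s t s′ t′} → point (s , t) ≡ point (s′ , t′) → (s , t) ≡ (s′ , t′)
    point-injective {s} {t} {s′} {t′} eq = cong (λ { (s ∷ t ∷ []) → s , t })
      (trans (sym (Vec.removeAt-insertAt (s ∷ t ∷ []) i 0ᶠ))
        (trans (cong (λ u → removeAt u i) eq) (Vec.removeAt-insertAt (s′ ∷ t′ ∷ []) i 0ᶠ)))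

    family≈ε : (φ : 𝔽 → 𝔽 × 𝔽) → (∀ j k → φ j ≡ φ k → j ≡ k) → QΣ.sum (λ k → line (point (φ k)) v) ≈ ε
    family≈ε φ φ-injective = cylinder≈ε (point ∘ φ) (λ k → Vec.insertAt-lookup _ i 0ᶠ)
      (λ j k eq → φ-injective j k (point-injective eq))

    -- Replace the line indexed by (s , t) in the cylinder of all (s , k) by the line indexed by (s′ , t′).
    exchange : ∀ {s s′} → s ≢ s′ → ∀ t t′ → line (point (s , t)) v ≈ line (point (s′ , t′)) v
    exchange {s} {s′} s≢s′ t t′ = x∙y⁻¹≈ε⇒x≈y _ _ (begin
      F (s , t) - F (s′ , t′)          ≡⟨ cong (λ z → F (s , t) - F z) (φ-t t refl) ⟨
      F (s , t) - F (φ t)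
        ≈⟨ QΣ.sum-single {f = λ k → F (s , k) - F (φ k)} t
             (λ k k≢t → x≈y⇒x∙y⁻¹≈ε (reflexive (cong F (sym (φ-≢ k k≢t))))) ⟨
      QΣ.sum (λ k → F (s , k) - F (φ k))
        ≈⟨ sum-minus quotientGroup δ (λ k → F (s , k)) (F ∘ φ) ⟩
      QΣ.sum (λ k → F (s , k)) - QΣ.sum (F ∘ φ)
        ≈⟨ ∙-cong (family≈ε (s ,_) (λ { j k refl → refl })) (≈-trans (⁻¹-cong (family≈ε φ φ-injective)) ε⁻¹≈ε) ⟩
      ε ∎)
      where
      open import Relation.Binary.Reasoning.Setoid setoid
      F : 𝔽 × 𝔽 → Point → ℤ
      F st = line (point st) v
      φ : 𝔽 → 𝔽 × 𝔽
      φ k = if does (k Fin.≟ t) then (s′ , t′) else (s , k)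
      φ-t : ∀ k → k ≡ t → φ k ≡ (s′ , t′)
      φ-t k k≡t rewrite dec-true (k Fin.≟ t) k≡t = refl
      φ-≢ : ∀ k → k ≢ t → φ k ≡ (s , k)
      φ-≢ k k≢t rewrite dec-false (k Fin.≟ t) k≢t = refl
      -- Because `s ≢ s′`, the substituted line is not already in the cylinder, so the modified
      -- family still consists of `p` disjoint lines.
      φ-injective : ∀ j k → φ j ≡ φ k → j ≡ k
      φ-injective j k eq with j Fin.≟ t | k Fin.≟ t
      ... | yes refl | yes refl = refl
      ... | yes j≡t  | no k≢t   = contradiction (cong proj₁ eq) (s≢s′ ∘ sym)
      ... | no j≢t   | yes k≡t  = contradiction (cong proj₁ eq) s≢s′
      ... | no j≢t   | no k≢t   = cong proj₂ eq

    point≈ : ∀ st st′ → line (point st) v ≈ line (point st′) v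
    point≈ (s , t) (s′ , t′) with s Fin.≟ s′
    ... | no s≢s′  = exchange s≢s′ t t′
    -- `exchange` needs different first indices, so two lines sharing `s` are compared through one
    -- indexed by `s +ᶠ 1ᶠ`.
    ... | yes refl = ≈-trans (exchange (s≢s+1) t t) (exchange (s≢s+1 ∘ sym) t t′)
      where
      s≢s+1 : s ≢ s +ᶠ 1ᶠ
      s≢s+1 eq = 1ᶠ≢0ᶠ (+ᶠ-cancelˡ s _ _ (trans (sym eq) (sym (+ᶠ-identityʳ s))))

    line-shift : ∀ b m → line b v ≈ line (b +ᵛ m *ᵛ v) v
    line-shift b m = ≗⇒≈ λ x → trans (line-apply b v v≢0 x) (trans
      (cong (λ d → if d then 1ℤ else 0ℤ) (does-⇔ (mk⇔ (to x) (from x)) (points? ℓ x) (points? ℓ′ x)))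
      (sym (line-apply (b +ᵛ m *ᵛ v) v v≢0 x)))
      where
      ℓ ℓ′ : Line
      ℓ  = lineThrough b v v≢0
      ℓ′ = lineThrough (b +ᵛ m *ᵛ v) v v≢0
      regroup : ∀ k → b +ᵛ ((k +ᶠ m) *ᵛ v +ᵛ 0ᵛ) ≡ b +ᵛ m *ᵛ v +ᵛ (k *ᵛ v +ᵛ 0ᵛ)
      regroup k = components b v
        where
        component : ∀ x y → x +ᶠ ((k +ᶠ m) *ᶠ y +ᶠ 0ᶠ) ≡ x +ᶠ m *ᶠ y +ᶠ (k *ᶠ y +ᶠ 0ᶠ)
        component x y = solve 4 (λ x y k m → x :+ ((k :+ m) :* y :+ con 0) := x :+ m :* y :+ (k :* y :+ con 0)) refl x y k m
        components : ∀ b v → b +ᵛ ((k +ᶠ m) *ᵛ v +ᵛ 0ᵛ) ≡ b +ᵛ m *ᵛ v +ᵛ (k *ᵛ v +ᵛ 0ᵛ)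
        components (x₁ ∷ x₂ ∷ x₃ ∷ []) (y₁ ∷ y₂ ∷ y₃ ∷ []) = vec₃ (component x₁ y₁) (component x₂ y₂) (component x₃ y₃)
      to : ∀ x → Points ℓ x → Points ℓ′ x
      to x (k ∷ [] , x≡) = k -ᶠ m ∷ [] ,
        trans x≡ (trans (cong (λ k → b +ᵛ (k *ᵛ v +ᵛ 0ᵛ)) (sym (a-b+b≡a k m))) (regroup (k -ᶠ m)))
      from : ∀ x → Points ℓ′ x → Points ℓ x
      from x (k ∷ [] , x≡) = k +ᶠ m ∷ [] , trans x≡ (sym (regroup k))

    normalise : ∀ b → ∃ λ st → line b v ≈ line (point st) v
    normalise b = st (removeAt c i) , ≈-trans (line-shift b m) (reflexive (cong (λ u → line u v)
      (trans (sym (Vec.insertAt-removeAt c i))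
        (trans (cong (insertAt (removeAt c i) i) cᵢ≡0) (point-st (removeAt c i))))))
      where
      a⁻¹ m : 𝔽
      a⁻¹ = proj₁ (inverse (lookup v i) vᵢ≢0)
      -- The multiple of `v` that slides the base point along its line until coordinate `i`
      -- vanishes.
      m = -1ᶠ *ᶠ (lookup b i *ᶠ a⁻¹)
      c : Point
      c = b +ᵛ m *ᵛ v
      cᵢ≡0 : lookup c i ≡ 0ᶠ
      cᵢ≡0 = begin
        lookup c i
          ≡⟨ lookup-+* b m ⟩
        lookup b i +ᶠ m *ᶠ lookup v i
          ≡⟨ solve 4 (λ b e a⁻¹ a → b :+ e :* (b :* a⁻¹) :* a := b :+ e :* (b :* (a⁻¹ :* a))) refl
               (lookup b i) -1ᶠ a⁻¹ (lookup v i) ⟩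
        lookup b i -ᶠ lookup b i *ᶠ (a⁻¹ *ᶠ lookup v i)
          ≡⟨ cong (λ o → lookup b i -ᶠ lookup b i *ᶠ o) (proj₂ (inverse (lookup v i) vᵢ≢0)) ⟩
        lookup b i -ᶠ lookup b i *ᶠ 1ᶠ
          ≡⟨ cong (lookup b i -ᶠ_) (*ᶠ-identityʳ (lookup b i)) ⟩
        lookup b i -ᶠ lookup b i
          ≡⟨ a-a≡0 (lookup b i) ⟩
        0ᶠ ∎
        where open ≡-Reasoning
      st : Vec 𝔽 2 → 𝔽 × 𝔽
      st (s ∷ t ∷ []) = s , t
      point-st : ∀ u → insertAt u i 0ᶠ ≡ point (st u)
      point-st (s ∷ t ∷ []) = refl

    line≈ : ∀ b b′ → line b v ≈ line b′ v
    line≈ b b′ = let st , b≈ = normalise b; st′ , b′≈ = normalise b′ in ≈-trans b≈ (≈-trans (point≈ st st′) (≈-sym b′≈))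

  -- Each line is represented by its point with vanishing coordinate `i`, and exchanging single
  -- lines of cylinders identifies all such representatives.
  line-invariant : ∀ v → v ≢ 0ᵛ → ∀ b b′ → line b v ≈ line b′ v
  line-invariant v v≢0 with i , vᵢ≢0 ← pivot v v≢0 = Transversal.line≈ v v≢0 i vᵢ≢0

  divisible-cylinders : ∀ w → Divisible w → total w ≡ p ^ 2 → toℤ w ∈Spanℤ 𝟙ᶜ
  divisible-cylinders w divisible total≡ = ≈ε⇒∈Span (≈-trans (divisible≈ line-invariant w divisible total≡)
    (≈-trans (≈-sym (lines≈ line-invariant e₁ c)) (cylinder≈ε c (λ _ → refl) λ { j k refl → refl })))
    where
    open Transversal e₁ (λ eq → 1ᶠ≢0ᶠ (cong (λ v → lookup v 0F) eq)) 0F 1ᶠ≢0ᶠ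
    -- The lines of direction `e₁` through these points fill the plane of vanishing third
    -- coordinate. It is a cylinder, so its class is zero, while `lines≈` gives that class as
    -- `p ^ 2 · δ 0ᵛ`.
    c : 𝔽 → Point
    c k = 0ᶠ ∷ k ∷ 0ᶠ ∷ []

theorem1p13 : (p : ℕ) (p-prime : Prime p) →
    let open AffineGeometry p p-prime in
    (w : Point → ℕ) → Divisible w → total w ≡ p ^ 2 →
    ((H : Plane) → toℤ w -ᵐ 𝟙ᴾ H ∈Spanℤ lineDifference) × (toℤ w ∈Spanℤ 𝟙ᶜ)
theorem1p13 p p-prime w divisible total≡ =
  PlaneCongruence.divisible-𝟙ᴾ p p-prime w divisible total≡ ,
  CylinderCongruence.divisible-cylinders p p-prime w divisible total≡
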